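{- Let $\alpha>0$. There exist constants $C>0$ and $\Delta_0$ (depending only on $\alpha$) such that for every finite graph $G$ with maximum degree $\Delta\ge \Delta_0$ and minimum degree $\delta(G)\geq \alpha\Delta$, the conflict-free chromatic number of $G$ satisfies $\chi_{CF}(G)\le C\ln\Delta$. (That is, $\chi_{CF}(G)=O(\ln\Delta)$ as $\Delta\to\infty$ for fixed $\alpha$.)
   Context: All graphs are finite and simple. For a vertex $v$ of $G$, the closed neighborhood $N[v]$ consists of $v$ and all its neighbors. A (not necessarily proper) coloring of the vertices of $G$ is conflict-free if for every vertex $v\in V(G)$ there is a color that appears on exactly one vertex of $N[v]$. The conflict-free chromatic number $\chi_{CF}(G)$ is the minimum number of colors in a conflict-free coloring of the vertices of $G$ (every vertex is colored). -}

module Defs where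

open import Data.Nat as ℕ using (ℕ; zero; suc; z≤n; s≤s)
import Data.Nat.Properties as ℕ
import Data.Nat.Solver as ℕ-Solver
open import Data.Integer as ℤ using (+_)
import Data.Integer.Properties as ℤ
open import Data.Rational as ℚ using (ℚ; 0ℚ; 1ℚ; ∣_∣; mkℚ; _/_; toℚᵘ; *<*)
import Data.Rational.Properties as ℚ
import Data.Rational.Unnormalised as ℚᵘ
import Data.Rational.Unnormalised.Properties as ℚᵘ
open import Data.Rational.Solver using (module +-*-Solver)
open import Data.Fin using (Fin; zero; suc)
import Data.Fin.Properties as Fin
open import Data.List using (length; filter; map; allFin)
open import Data.List.Extrema.Nat using (max; min)
open import Data.Product using (∃; ∃!; _×_; _,_; proj₁; proj₂)
open import Data.Sum using (_⊎_; inj₁; inj₂)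
open import Data.Vec using (Vec; []; _∷_; lookup; tabulate)
open import Data.Vec.Properties using (lookup∘tabulate)
open import Function using (_∘_; id)
open import Relation.Binary using (Symmetric; Irreflexive)
import Relation.Binary as B
open import Relation.Binary.PropositionalEquality using (_≡_; refl; sym; trans; cong; cong₂; subst; subst₂; module ≡-Reasoning)
open import Relation.Nullary using (¬_; Dec; yes; no; contradiction; _×-dec_; _⊎-dec_; _→-dec_)
open import Relation.Nullary.Decidable using (map′)
open import Relation.Unary using (Pred; Decidable)
open import Level using (0ℓ)

record Graph : Set₁ where
  field
    order  : ℕ
    _~_    : B.Rel (Fin order) 0ℓ
    _~?_   : B.Decidable _~_
    ~-sym  : Symmetric _~_
    ~-irr  : Irreflexive _≡_ _~_

  Vertex : Set
  Vertex = Fin order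

  degree : Vertex → ℕ
  degree v = length (filter (v ~?_) (allFin order))

  -- The first arguments of max and min are values for the empty list; every
  -- degree is < order, so they do not matter for a graph with a vertex.
  maxDegree minDegree : ℕ
  maxDegree = max 0 (map degree (allFin order))
  minDegree = min order (map degree (allFin order))

  _∈N[_] : Vertex → Vertex → Set
  w ∈N[ v ] = w ≡ v ⊎ v ~ w

  ConflictFree : ∀ {k} → (Vertex → Fin k) → Set
  ConflictFree c = ∀ v → ∃ λ i → ∃! _≡_ λ w → w ∈N[ v ] × c w ≡ i

  CFColourable : ℕ → Set
  CFColourable k = ∃ λ (c : Vertex → Fin k) → ConflictFree c

IsMinimum : Pred ℕ 0ℓ → Pred ℕ 0ℓ
IsMinimum P k = P k × (∀ j → P j → k ℕ.≤ j)

minimum : {P : Pred ℕ 0ℓ} → Decidable P → ∀ n → P n → ∃ (IsMinimum P)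
minimum P? zero p = 0 , p , λ _ _ → z≤n
minimum {P} P? (suc n) p with P? 0
... | yes p₀ = 0 , p₀ , λ _ _ → z≤n
... | no ¬p₀ with minimum (P? ∘ suc) n p
...   | k , pk , k-min = suc k , pk , least
  where
  least : ∀ j → P j → suc k ℕ.≤ j
  least zero    p₀ = contradiction p₀ ¬p₀
  least (suc j) pj = s≤s (k-min j pj)

module _ {k : ℕ} where

  anyVec? : ∀ {n} {P : Pred (Vec (Fin k) n) 0ℓ} → Decidable P → Dec (∃ P)
  anyVec? {zero}  P? = map′ ([] ,_) (λ { ([] , p) → p }) (P? [])
  anyVec? {suc n} P? =
    map′ (λ { (x , xs , p) → x ∷ xs , p }) (λ { (x ∷ xs , p) → x , xs , p })
         (Fin.any? λ x → anyVec? λ xs → P? (x ∷ xs))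

module _ (G : Graph) where
  open Graph G

  conflictFree? : ∀ {k} → Decidable (ConflictFree {k})
  conflictFree? c = Fin.all? λ v → Fin.any? λ i → unique? (λ w →
      (w Fin.≟ v ⊎-dec v ~? w) ×-dec c w Fin.≟ i)
    where
    unique? : {P : Pred Vertex 0ℓ} → Decidable P → Dec (∃! _≡_ P)
    unique? P? = Fin.any? λ w → P? w ×-dec
      map′ (λ f {y} → f y) (λ f y → f {y}) (Fin.all? λ y → P? y →-dec w Fin.≟ y)

  conflictFree-cong : ∀ {k} {c d : Vertex → Fin k} → (∀ v → c v ≡ d v) →
                      ConflictFree c → ConflictFree d
  conflictFree-cong c≗d cf v with cf v
  ... | i , w , (w∈N , cw≡i) , unq =
    i , w , (w∈N , trans (sym (c≗d w)) cw≡i) ,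
    λ { {y} (y∈N , dy≡i) → unq (y∈N , trans (c≗d y) dy≡i) }

  cfColourable? : Decidable CFColourable
  cfColourable? k =
    map′ (λ { (xs , cf) → lookup xs , cf })
         (λ { (c , cf) → tabulate c , conflictFree-cong (sym ∘ lookup∘tabulate c) cf })
         (anyVec? (conflictFree? ∘ lookup))

  cfColourable-order : CFColourable order
  cfColourable-order = id , λ v → v , v , (inj₁ refl , refl) , λ { (_ , y≡v) → sym y≡v }

  χCF-exists : ∃ (IsMinimum CFColourable)
  χCF-exists = minimum cfColourable? order cfColourable-order

  χCF : ℕ
  χCF = proj₁ χCF-exists

-- A real number is a Cauchy sequence of rationals with a modulus; sequences are
-- compared only through _≤ℝ_ and _<ℝ_, so no quotient is needed.
Cauchy : (ℕ → ℚ) → Set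
Cauchy x = ∀ ε → 0ℚ ℚ.< ε → ∃ λ N → ∀ m n → N ℕ.≤ m → N ℕ.≤ n → ∣ x m ℚ.- x n ∣ ℚ.≤ ε

record ℝ : Set where
  constructor mkℝ
  field
    seq    : ℕ → ℚ
    cauchy : Cauchy seq

open ℝ public

infix 4 _≤ℝ_ _<ℝ_
infixl 7 _*ℝ_

_≤ℝ_ : ℝ → ℝ → Set
x ≤ℝ y = ∀ ε → 0ℚ ℚ.< ε → ∃ λ N → ∀ n → N ℕ.≤ n → seq x n ℚ.≤ seq y n ℚ.+ ε

_<ℝ_ : ℝ → ℝ → Set
x <ℝ y = ∃ λ ε → 0ℚ ℚ.< ε × ∃ λ N → ∀ n → N ℕ.≤ n → seq x n ℚ.+ ε ℚ.≤ seq y n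

fromℚ : ℚ → ℝ
fromℚ q = mkℝ (λ _ → q) λ ε 0<ε →
  0 , λ _ _ _ _ → subst (λ z → ∣ z ∣ ℚ.≤ ε) (sym (ℚ.+-inverseʳ q)) (ℚ.<⇒≤ 0<ε)

fromℕ : ℕ → ℝ
fromℕ n = fromℚ (+ n / 1)

0ℝ : ℝ
0ℝ = fromℚ 0ℚ

module _ where
  open +-*-Solver

  -- Stated for variables: the solver is slow on compound subterms.
  p≡q+[p-q] : ∀ p q → p ≡ q ℚ.+ (p ℚ.- q)
  p≡q+[p-q] = solve 2 (λ a b → a := b :+ (a :- b)) refl

  p+q-q≡p : ∀ p q → p ℚ.+ q ℚ.- q ≡ p
  p+q-q≡p = solve 2 (λ p q → p :+ q :- q := p) refl

  q+p-q≡p : ∀ p q → q ℚ.+ p ℚ.- q ≡ p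
  q+p-q≡p = solve 2 (λ p q → q :+ p :- q := p) refl

  -[p-q]≡q-p : ∀ p q → ℚ.- (p ℚ.- q) ≡ q ℚ.- p
  -[p-q]≡q-p = solve 2 (λ p q → :- (p :- q) := q :- p) refl

  difference-of-products : ∀ a b c d →
    a ℚ.* b ℚ.- c ℚ.* d ≡ a ℚ.* (b ℚ.- d) ℚ.+ (a ℚ.- c) ℚ.* d
  difference-of-products =
    solve 4 (λ a b c d → a :* b :- c :* d := a :* (b :- d) :+ (a :- c) :* d) refl

  factor-out : ∀ a b e → a ℚ.* e ℚ.+ e ℚ.* b ≡ e ℚ.* (a ℚ.+ b)
  factor-out = solve 3 (λ a b e → a :* e :+ e :* b := e :* (a :+ b)) refl

eventually-bounded : ∀ x → Cauchy x →
  ∃ λ B → ℚ.Positive B × ∃ λ N → ∀ n → N ℕ.≤ n → ∣ x n ∣ ℚ.≤ B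
eventually-bounded x cx with cx 1ℚ (ℚ.positive⁻¹ 1ℚ)
... | N , close = ∣ x N ∣ ℚ.+ 1ℚ ,
      ℚ.nonNeg+pos⇒pos ∣ x N ∣ {{ℚ.∣-∣-nonNeg (x N)}} 1ℚ , N , bound
  where
  open ℚ.≤-Reasoning
  bound : ∀ n → N ℕ.≤ n → ∣ x n ∣ ℚ.≤ ∣ x N ∣ ℚ.+ 1ℚ
  bound n N≤n = begin
    ∣ x n ∣                            ≡⟨ cong ∣_∣ (p≡q+[p-q] (x n) (x N)) ⟩
    ∣ x N ℚ.+ (x n ℚ.- x N) ∣          ≤⟨ ℚ.∣p+q∣≤∣p∣+∣q∣ (x N) (x n ℚ.- x N) ⟩
    ∣ x N ∣ ℚ.+ ∣ x n ℚ.- x N ∣        ≤⟨ ℚ.+-monoʳ-≤ ∣ x N ∣ (close n N N≤n ℕ.≤-refl) ⟩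
    ∣ x N ∣ ℚ.+ 1ℚ                     ∎

divide : ∀ ε D → 0ℚ ℚ.< ε → ℚ.Positive D → ∃ λ η → 0ℚ ℚ.< η × η ℚ.* D ≡ ε
divide ε D 0<ε D>0 = ε ℚ.* D⁻¹ , 0<η , eq
  where
  instance
    _ = D>0
    D≢0 : ℚ.NonZero D
    D≢0 = ℚ.pos⇒nonZero D
  D⁻¹ : ℚ
  D⁻¹ = ℚ.1/ D
  0<η : 0ℚ ℚ.< ε ℚ.* D⁻¹
  0<η = subst (ℚ._< ε ℚ.* D⁻¹) (ℚ.*-zeroˡ D⁻¹) (ℚ.*-monoˡ-<-pos D⁻¹ {{ℚ.1/pos⇒pos D}} 0<ε)
  eq : ε ℚ.* D⁻¹ ℚ.* D ≡ ε
  eq = trans (ℚ.*-assoc ε D⁻¹ D) (trans (cong (ε ℚ.*_) (ℚ.*-inverseˡ D)) (ℚ.*-identityʳ ε))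

∣*∣-mono : ∀ {p q r s} → ∣ p ∣ ℚ.≤ r → ∣ q ∣ ℚ.≤ s → ∣ p ℚ.* q ∣ ℚ.≤ r ℚ.* s
∣*∣-mono {p} {q} {r} {s} p≤r q≤s = begin
  ∣ p ℚ.* q ∣      ≡⟨ ℚ.∣p*q∣≡∣p∣*∣q∣ p q ⟩
  ∣ p ∣ ℚ.* ∣ q ∣  ≤⟨ ℚ.*-monoʳ-≤-nonNeg ∣ q ∣ {{ℚ.∣-∣-nonNeg q}} p≤r ⟩
  r ℚ.* ∣ q ∣      ≤⟨ ℚ.*-monoˡ-≤-nonNeg r {{ℚ.nonNegative (ℚ.≤-trans (ℚ.0≤∣p∣ p) p≤r)}} q≤s ⟩
  r ℚ.* s          ∎
  where open ℚ.≤-Reasoning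

product-close : ∀ {x y x′ y′ A B η} → ∣ x ∣ ℚ.≤ A → ∣ y′ ∣ ℚ.≤ B →
  ∣ x ℚ.- x′ ∣ ℚ.≤ η → ∣ y ℚ.- y′ ∣ ℚ.≤ η → ∣ x ℚ.* y ℚ.- x′ ℚ.* y′ ∣ ℚ.≤ η ℚ.* (A ℚ.+ B)
product-close {x} {y} {x′} {y′} {A} {B} {η} x≤A y′≤B x-close y-close = begin
  ∣ x ℚ.* y ℚ.- x′ ℚ.* y′ ∣
    ≡⟨ cong ∣_∣ (difference-of-products x y x′ y′) ⟩
  ∣ x ℚ.* (y ℚ.- y′) ℚ.+ (x ℚ.- x′) ℚ.* y′ ∣
    ≤⟨ ℚ.∣p+q∣≤∣p∣+∣q∣ (x ℚ.* (y ℚ.- y′)) ((x ℚ.- x′) ℚ.* y′) ⟩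
  ∣ x ℚ.* (y ℚ.- y′) ∣ ℚ.+ ∣ (x ℚ.- x′) ℚ.* y′ ∣
    ≤⟨ ℚ.+-mono-≤ (∣*∣-mono {x} {y ℚ.- y′} x≤A y-close) (∣*∣-mono {x ℚ.- x′} {y′} x-close y′≤B) ⟩
  A ℚ.* η ℚ.+ η ℚ.* B
    ≡⟨ factor-out A B η ⟩
  η ℚ.* (A ℚ.+ B) ∎
  where open ℚ.≤-Reasoning

*-cauchy : ∀ x y → Cauchy x → Cauchy y → Cauchy (λ n → x n ℚ.* y n)
*-cauchy x y cx cy ε 0<ε =
  let A , A>0 , N₁ , ∣x∣≤A = eventually-bounded x cx
      B , B>0 , N₂ , ∣y∣≤B = eventually-bounded y cy
      η , 0<η , ηD≡ε = divide ε (A ℚ.+ B) 0<ε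
                         (ℚ.nonNeg+pos⇒pos A {{ℚ.pos⇒nonNeg A {{A>0}}}} B {{B>0}})
      N₃ , x-close = cx η 0<η
      N₄ , y-close = cy η 0<η
  in (N₁ ℕ.+ N₂) ℕ.+ (N₃ ℕ.+ N₄) , λ m n N≤m N≤n →
     subst (∣ x m ℚ.* y m ℚ.- x n ℚ.* y n ∣ ℚ.≤_) ηD≡ε
       (product-close {x m} {y m} {x n} {y n} {A} {B} {η}
         (∣x∣≤A m (ℕ.m+n≤o⇒m≤o N₁ (ℕ.m+n≤o⇒m≤o (N₁ ℕ.+ N₂) N≤m)))
         (∣y∣≤B n (ℕ.m+n≤o⇒n≤o N₁ (ℕ.m+n≤o⇒m≤o (N₁ ℕ.+ N₂) N≤n)))
         (x-close m n (ℕ.m+n≤o⇒m≤o N₃ (ℕ.m+n≤o⇒n≤o (N₁ ℕ.+ N₂) N≤m))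
                      (ℕ.m+n≤o⇒m≤o N₃ (ℕ.m+n≤o⇒n≤o (N₁ ℕ.+ N₂) N≤n)))
         (y-close m n (ℕ.m+n≤o⇒n≤o N₃ (ℕ.m+n≤o⇒n≤o (N₁ ℕ.+ N₂) N≤m))
                      (ℕ.m+n≤o⇒n≤o N₃ (ℕ.m+n≤o⇒n≤o (N₁ ℕ.+ N₂) N≤n))))

_*ℝ_ : ℝ → ℝ → ℝ
x *ℝ y = mkℝ (λ n → seq x n ℚ.* seq y n) (*-cauchy (seq x) (seq y) (cauchy x) (cauchy y))

harmonic : ℕ → ℕ → ℚ
harmonic a zero    = 0ℚ
harmonic a (suc k) = harmonic a k ℚ.+ + 1 / suc (a ℕ.+ k)

-- ln m is the integral of 1/t over [1 , m].  Its right Riemann sum with mesh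
-- 1/M (here M = N + 1) is  Σ_{j=1}^{(m-1)M} (1/M) · 1/(1 + j/M) = Σ_j 1/(M + j).
-- The value at m = 0 is a dummy 0.
lnSeq : ℕ → ℕ → ℚ
lnSeq m N = harmonic (suc N) ((m ℕ.∸ 1) ℕ.* suc N)

/-mono : ∀ a b c d → a ℕ.* suc d ℕ.≤ c ℕ.* suc b → + a / suc b ℚ.≤ + c / suc d
/-mono a b c d h = ℚ.toℚᵘ-cancel-≤ (begin
  toℚᵘ (+ a / suc b)    ≃⟨ ℚ.toℚᵘ-fromℚᵘ (ℚᵘ.mkℚᵘ (+ a) b) ⟩
  ℚᵘ.mkℚᵘ (+ a) b       ≤⟨ ℚᵘ.*≤* (subst₂ ℤ._≤_ (ℤ.pos-* a (suc d)) (ℤ.pos-* c (suc b)) (ℤ.+≤+ h)) ⟩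
  ℚᵘ.mkℚᵘ (+ c) d       ≃⟨ ℚᵘ.≃-sym (ℚ.toℚᵘ-fromℚᵘ (ℚᵘ.mkℚᵘ (+ c) d)) ⟩
  toℚᵘ (+ c / suc d)    ∎)
  where open ℚᵘ.≤-Reasoning

/-suc : ∀ k c → + suc k / suc c ≡ + k / suc c ℚ.+ + 1 / suc c
/-suc k c = ℚ.toℚᵘ-injective (begin
  toℚᵘ (+ suc k / suc c)                            ≈⟨ ℚ.toℚᵘ-fromℚᵘ (ℚᵘ.mkℚᵘ (+ suc k) c) ⟩
  ℚᵘ.mkℚᵘ (+ suc k) c                               ≈⟨ ℚᵘ.*≡* eq ⟩
  ℚᵘ.mkℚᵘ (+ k) c ℚᵘ.+ ℚᵘ.mkℚᵘ (+ 1) c              ≈⟨ ℚᵘ.+-cong (ℚᵘ.≃-sym (ℚ.toℚᵘ-fromℚᵘ (ℚᵘ.mkℚᵘ (+ k) c)))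
                                                                  (ℚᵘ.≃-sym (ℚ.toℚᵘ-fromℚᵘ (ℚᵘ.mkℚᵘ (+ 1) c))) ⟩
  toℚᵘ (+ k / suc c) ℚᵘ.+ toℚᵘ (+ 1 / suc c)        ≈⟨ ℚᵘ.≃-sym (ℚ.toℚᵘ-homo-+ (+ k / suc c) (+ 1 / suc c)) ⟩
  toℚᵘ (+ k / suc c ℚ.+ + 1 / suc c)                ∎)
  where
  open import Relation.Binary.Reasoning.Setoid ℚᵘ.≃-setoid
  open ℕ-Solver.+-*-Solver
  eq : + suc k ℤ.* + (suc c ℕ.* suc c) ≡ (+ k ℤ.* + suc c ℤ.+ + 1 ℤ.* + suc c) ℤ.* + suc c
  eq = trans (sym (ℤ.pos-* (suc k) (suc c ℕ.* suc c)))
    (trans (cong +_ (solve 2 (λ k s → (con 1 :+ k) :* (s :* s) := (k :* s :+ con 1 :* s) :* s) refl k (suc c)))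
    (trans (ℤ.pos-* (k ℕ.* suc c ℕ.+ 1 ℕ.* suc c) (suc c))
      (cong (ℤ._* + suc c) (cong₂ ℤ._+_ (ℤ.pos-* k (suc c)) (ℤ.pos-* 1 (suc c))))))

0/ : ∀ c → + 0 / suc c ≡ 0ℚ
0/ c = ℚ.≤-antisym (/-mono 0 c 0 0 z≤n) (/-mono 0 0 0 c z≤n)

1/-anti : ∀ {a b} → a ℕ.≤ b → + 1 / suc b ℚ.≤ + 1 / suc a
1/-anti {a} {b} a≤b = /-mono 1 b 1 a (ℕ.*-monoʳ-≤ 1 (s≤s a≤b))

harmonic-split : ∀ a k l → harmonic a (k ℕ.+ l) ≡ harmonic a k ℚ.+ harmonic (a ℕ.+ k) l
harmonic-split a k zero =
  trans (cong (harmonic a) (ℕ.+-identityʳ k)) (sym (ℚ.+-identityʳ (harmonic a k)))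
harmonic-split a k (suc l) rewrite ℕ.+-suc k l | harmonic-split a k l | ℕ.+-assoc a k l =
  ℚ.+-assoc (harmonic a k) _ _

harmonic-lower : ∀ a k c → a ℕ.+ k ℕ.≤ suc c → + k / suc c ℚ.≤ harmonic a k
harmonic-lower a zero    c _ = ℚ.≤-reflexive (0/ c)
harmonic-lower a (suc k) c h = ℚ.≤-trans (ℚ.≤-reflexive (/-suc k c))
  (ℚ.+-mono-≤ (harmonic-lower a k c (ℕ.m≤n⇒m≤1+n a+k≤c)) (1/-anti a+k≤c))
  where
  a+k≤c : a ℕ.+ k ℕ.≤ c
  a+k≤c = ℕ.≤-pred (subst (ℕ._≤ suc c) (ℕ.+-suc a k) h)

harmonic-upper : ∀ a k → harmonic a k ℚ.≤ + k / suc a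
harmonic-upper a zero    = ℚ.≤-reflexive (sym (0/ a))
harmonic-upper a (suc k) = ℚ.≤-trans
  (ℚ.+-mono-≤ (harmonic-upper a k) (1/-anti (ℕ.m≤m+n a k))) (ℚ.≤-reflexive (sym (/-suc k a)))

harmonic-head : ∀ a k → harmonic a (suc k) ≡ + 1 / suc a ℚ.+ harmonic (suc a) k
harmonic-head a k = begin
  harmonic a (1 ℕ.+ k)                                 ≡⟨ harmonic-split a 1 k ⟩
  0ℚ ℚ.+ + 1 / suc (a ℕ.+ 0) ℚ.+ harmonic (a ℕ.+ 1) k  ≡⟨ cong (ℚ._+ harmonic (a ℕ.+ 1) k) (ℚ.+-identityˡ (+ 1 / suc (a ℕ.+ 0))) ⟩
  + 1 / suc (a ℕ.+ 0) ℚ.+ harmonic (a ℕ.+ 1) k         ≡⟨ cong₂ (λ u v → + 1 / suc u ℚ.+ harmonic v k)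
                                                            (ℕ.+-identityʳ a) (ℕ.+-comm a 1) ⟩
  + 1 / suc a ℚ.+ harmonic (suc a) k                   ∎
  where open ≡-Reasoning

module _ (p : ℕ) where

  lnSeq-step : ∀ N → let M = suc N in
    + 1 / suc M ℚ.+ lnSeq (suc p) M ≡ lnSeq (suc p) N ℚ.+ harmonic (M ℕ.+ p ℕ.* M) (suc p)
  lnSeq-step N = begin
    + 1 / suc M ℚ.+ harmonic (suc M) (p ℕ.* suc M)        ≡⟨ sym (harmonic-head M (p ℕ.* suc M)) ⟩
    harmonic M (suc (p ℕ.* suc M))                        ≡⟨ cong (harmonic M) (solve 2 (λ p m →
                                                               con 1 :+ p :* (con 1 :+ m) := p :* m :+ (con 1 :+ p)) refl p M) ⟩
    harmonic M (p ℕ.* M ℕ.+ suc p)                        ≡⟨ harmonic-split M (p ℕ.* M) (suc p) ⟩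
    harmonic M (p ℕ.* M) ℚ.+ harmonic (M ℕ.+ p ℕ.* M) (suc p) ∎
    where
    M = suc N
    open ≡-Reasoning
    open ℕ-Solver.+-*-Solver

  lnSeq-up : ∀ N → lnSeq (suc p) N ℚ.≤ lnSeq (suc p) (suc N)
  lnSeq-up N = begin
    lnSeq (suc p) N                                                     ≡⟨ sym (p+q-q≡p (lnSeq (suc p) N) r) ⟩
    lnSeq (suc p) N ℚ.+ r ℚ.- r                                         ≤⟨ ℚ.+-monoˡ-≤ (ℚ.- r) (ℚ.+-monoʳ-≤ (lnSeq (suc p) N) r≤) ⟩
    lnSeq (suc p) N ℚ.+ harmonic (M ℕ.+ p ℕ.* M) (suc p) ℚ.- r          ≡⟨ cong (ℚ._- r) (sym (lnSeq-step N)) ⟩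
    r ℚ.+ lnSeq (suc p) M ℚ.- r                                         ≡⟨ q+p-q≡p (lnSeq (suc p) M) r ⟩
    lnSeq (suc p) M                                                     ∎
    where
    M = suc N
    r = + 1 / suc M
    c = M ℕ.+ p ℕ.* M ℕ.+ p
    open ℚ.≤-Reasoning
    module S = ℕ-Solver.+-*-Solver
    r≤ : r ℚ.≤ harmonic (M ℕ.+ p ℕ.* M) (suc p)
    r≤ = ℚ.≤-trans
      (/-mono 1 M (suc p) c (ℕ.≤-reflexive (S.solve 2 (λ m p →
        S.con 1 S.:* (S.con 1 S.:+ (m S.:+ p S.:* m S.:+ p)) S.:=
        (S.con 1 S.:+ p) S.:* (S.con 1 S.:+ m)) refl M p)))
      (harmonic-lower (M ℕ.+ p ℕ.* M) (suc p) c (ℕ.≤-reflexive (ℕ.+-suc _ p)))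

  lnSeq-down : ∀ N → lnSeq (suc p) (suc N) ℚ.+ + 1 / suc (suc N) ℚ.≤ lnSeq (suc p) N ℚ.+ + 1 / suc N
  lnSeq-down N = begin
    lnSeq (suc p) M ℚ.+ + 1 / suc M                         ≡⟨ ℚ.+-comm (lnSeq (suc p) M) _ ⟩
    + 1 / suc M ℚ.+ lnSeq (suc p) M                         ≡⟨ lnSeq-step N ⟩
    lnSeq (suc p) N ℚ.+ harmonic (M ℕ.+ p ℕ.* M) (suc p)    ≤⟨ ℚ.+-monoʳ-≤ (lnSeq (suc p) N) ≤r ⟩
    lnSeq (suc p) N ℚ.+ + 1 / suc N                         ∎
    where
    M = suc N
    open ℚ.≤-Reasoning
    ≤r : harmonic (M ℕ.+ p ℕ.* M) (suc p) ℚ.≤ + 1 / suc N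
    ≤r = ℚ.≤-trans (harmonic-upper (M ℕ.+ p ℕ.* M) (suc p))
      (/-mono (suc p) (M ℕ.+ p ℕ.* M) 1 N
        (ℕ.≤-trans (ℕ.n≤1+n (suc p ℕ.* M)) (ℕ.≤-reflexive (sym (ℕ.*-identityˡ _)))))

  lnSeq-mono : ∀ {M N} → M ℕ.≤′ N → lnSeq (suc p) M ℚ.≤ lnSeq (suc p) N
  lnSeq-mono ℕ.≤′-refl         = ℚ.≤-refl
  lnSeq-mono (ℕ.≤′-step M≤′N) = ℚ.≤-trans (lnSeq-mono M≤′N) (lnSeq-up _)

  lnSeq-anti : ∀ {M N} → M ℕ.≤′ N →
               lnSeq (suc p) N ℚ.+ + 1 / suc N ℚ.≤ lnSeq (suc p) M ℚ.+ + 1 / suc M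
  lnSeq-anti ℕ.≤′-refl         = ℚ.≤-refl
  lnSeq-anti (ℕ.≤′-step M≤′N) = ℚ.≤-trans (lnSeq-down _) (lnSeq-anti M≤′N)

  lnSeq-close : ∀ {M N} → M ℕ.≤ N → ∣ lnSeq (suc p) N ℚ.- lnSeq (suc p) M ∣ ℚ.≤ + 1 / suc M
  lnSeq-close {M} {N} M≤N = begin
    ∣ y ℚ.- x ∣          ≡⟨ ℚ.0≤p⇒∣p∣≡p 0≤y-x ⟩
    y ℚ.- x              ≡⟨ cong (ℚ._- x) (sym (ℚ.+-identityʳ y)) ⟩
    y ℚ.+ 0ℚ ℚ.- x       ≤⟨ ℚ.+-monoˡ-≤ (ℚ.- x) (ℚ.+-monoʳ-≤ y 0≤s) ⟩
    y ℚ.+ s ℚ.- x        ≤⟨ ℚ.+-monoˡ-≤ (ℚ.- x) (lnSeq-anti (ℕ.≤⇒≤′ M≤N)) ⟩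
    x ℚ.+ r ℚ.- x        ≡⟨ q+p-q≡p r x ⟩
    r                    ∎
    where
    x = lnSeq (suc p) M
    y = lnSeq (suc p) N
    r = + 1 / suc M
    s = + 1 / suc N
    open ℚ.≤-Reasoning
    0≤s : 0ℚ ℚ.≤ s
    0≤s = /-mono 0 0 1 N z≤n
    0≤y-x : 0ℚ ℚ.≤ y ℚ.- x
    0≤y-x = subst (ℚ._≤ y ℚ.- x) (ℚ.+-inverseʳ x) (ℚ.+-monoˡ-≤ (ℚ.- x) (lnSeq-mono (ℕ.≤⇒≤′ M≤N)))

archimedean : ∀ ε → 0ℚ ℚ.< ε → ∃ λ N → + 1 / suc N ℚ.≤ ε
archimedean ε@(mkℚ (+ zero) d _)    (*<* (ℤ.+<+ ()))
archimedean ε@(mkℚ (+ suc n) d _)   _ = d ,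
  subst (+ 1 / suc d ℚ.≤_) (ℚ.↥p/↧p≡p ε) (/-mono 1 d (suc n) d (ℕ.*-monoˡ-≤ (suc d) (s≤s (z≤n {n}))))
archimedean ε@(mkℚ (ℤ.-[1+ n ]) d _) (*<* ())

lnSeq-cauchy : ∀ m → Cauchy (lnSeq m)
lnSeq-cauchy zero    = cauchy 0ℝ
lnSeq-cauchy (suc p) ε 0<ε with archimedean ε 0<ε
... | K , 1/K≤ε = K , close
  where
  close : ∀ M N → K ℕ.≤ M → K ℕ.≤ N → ∣ lnSeq (suc p) M ℚ.- lnSeq (suc p) N ∣ ℚ.≤ ε
  close M N K≤M K≤N with ℕ.≤-total N M
  ... | inj₁ N≤M = ℚ.≤-trans (lnSeq-close p N≤M) (ℚ.≤-trans (1/-anti K≤N) 1/K≤ε)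
  ... | inj₂ M≤N = subst (ℚ._≤ ε) flip
        (ℚ.≤-trans (lnSeq-close p M≤N) (ℚ.≤-trans (1/-anti K≤M) 1/K≤ε))
    where
    x = lnSeq (suc p) M
    y = lnSeq (suc p) N
    flip : ∣ y ℚ.- x ∣ ≡ ∣ x ℚ.- y ∣
    flip = trans (sym (ℚ.∣-p∣≡∣p∣ (y ℚ.- x)))
                 (cong ∣_∣ (-[p-q]≡q-p y x))

ln : ℕ → ℝ
ln m = mkℝ (lnSeq m) (lnSeq-cauchy m)

{-# OPTIONS --safe #-}

-- Put m = 2 (Δ + 1) and let k be a large multiple of ln Δ.  Colour every vertex
-- independently: each of k proper colours has weight 1 and a blank colour has
-- weight m.  In a closed neighbourhood of size D, where αΔ ≤ D ≤ Δ + 1, a given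
-- proper colour occurs exactly once with probability bounded below by a constant
-- depending on α.  If each vertex picked every proper colour independently with
-- odds 1 : m, the k colours would be independent and the probability that none
-- is unique would be (1 - c)^k.  Our colouring is that process conditioned on
-- each vertex picking at most one colour, an event that within one neighbourhood
-- has probability at least 1/2 once k² ≤ Δ; so conditioning costs a factor of
-- at most 2.  The failure probability is thus at most 1 / (4 (Δ + 1)²), and as
-- each event meets at most (Δ + 1)² others, the Local Lemma applies.
module Submission where

open import Defs
open import Data.Nat using (ℕ; _≤_)
open import Data.Product using (Σ-syntax; _×_)
open Graph using (maxDegree; minDegree)

open import Data.Nat using (zero; suc; _+_; _*_; _∸_; _^_; _<_; _≤?_; z≤n; s≤s; NonZero; >-nonZero; >-nonZero⁻¹)
open import Data.Nat.Properties
open import Data.Nat.Solver using (module +-*-Solver)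
open import Algebra.Properties.Semiring.Sum +-*-semiring using (sum; sum-cong-≗; sum-replicate-zero; *-distribˡ-sum; *-distribʳ-sum; ∑-distrib-+; ∑-comm)
open import Algebra.Properties.CommutativeMonoid.Sum *-1-commutativeMonoid using () renaming (sum to ∏; sum-cong-≗ to ∏-cong)
open import Data.Bool using (if_then_else_; true; false)
open import Data.Fin using (Fin; zero; suc)
import Data.Fin.Properties as Fin
open import Data.Integer using (+_)
import Data.Integer as ℤ
import Data.Integer.Properties as ℤ
open import Data.List using (List; []; _∷_; length; filter; map; allFin)
import Data.List as List
open import Data.List.Extrema.Nat using (xs≤max; min≤xs)
open import Data.List.Membership.Propositional using (_∈_)
open import Data.List.Membership.Propositional.Properties using (∈-filter⁻; ∈-allFin; ∈-map⁺)
open import Data.List.Properties using (filter-notAll)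
open import Data.List.Relation.Unary.All using (All; []; _∷_)
import Data.List.Relation.Unary.All as All
open import Data.List.Relation.Unary.All.Properties using (all-filter)
import Data.List.Relation.Unary.Any as Any
open import Data.Product using (∃; ∃!; _,_; proj₁; proj₂)
open import Data.Rational using (_/_; 0ℚ; 1ℚ; toℚᵘ)
import Data.Rational as ℚ
import Data.Rational.Properties as ℚ
import Data.Rational.Unnormalised as ℚᵘ
import Data.Rational.Unnormalised.Properties as ℚᵘ
open import Data.Sum using (inj₁; inj₂)
open import Data.Vec using (Vec; []; _∷_; lookup)
open import Function using (_∘_; id)
open import Level using (0ℓ)
open import Relation.Binary.PropositionalEquality using (_≡_; refl; sym; trans; cong; cong₂; subst; subst₂; module ≡-Reasoning)
open import Relation.Nullary using (¬_; Dec; yes; no; does; contradiction; _×-dec_; _⊎-dec_)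
open import Relation.Unary using (Pred; Decidable; ∁)
open import Relation.Unary.Properties using (∁?)

-- Weighted sums over letters and over words

sum-mono : ∀ {n} {f g : Fin n → ℕ} → (∀ i → f i ≤ g i) → sum f ≤ sum g
sum-mono {zero}  h = z≤n
sum-mono {suc n} h = +-mono-≤ (h zero) (sum-mono (h ∘ suc))

sum>0⇒∃ : ∀ {n} (f : Fin n → ℕ) → 0 < sum f → ∃ λ i → 0 < f i
sum>0⇒∃ {suc n} f h with f zero in eq
... | suc _ = zero , subst (0 <_) (sym eq) (s≤s z≤n)
... | zero  = let i , p = sum>0⇒∃ (f ∘ suc) h in suc i , p

module WeightedSum {a} (w : Fin a → ℕ) where

  S : (Fin a → ℕ) → ℕ
  S f = sum λ x → w x * f x

  W : ℕ
  W = sum w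

  S-cong : ∀ {f g} → (∀ x → f x ≡ g x) → S f ≡ S g
  S-cong h = sum-cong-≗ λ x → cong (w x *_) (h x)

  S-mono : ∀ {f g} → (∀ x → f x ≤ g x) → S f ≤ S g
  S-mono h = sum-mono λ x → *-monoʳ-≤ (w x) (h x)

  S-+ : ∀ f g → S (λ x → f x + g x) ≡ S f + S g
  S-+ f g = trans (sum-cong-≗ λ x → *-distribˡ-+ (w x) (f x) (g x))
                  (∑-distrib-+ (λ x → w x * f x) (λ x → w x * g x))

  S-*ʳ : ∀ f c → S (λ x → f x * c) ≡ S f * c
  S-*ʳ f c = trans (sum-cong-≗ λ x → sym (*-assoc (w x) (f x) c)) (sym (*-distribʳ-sum c λ x → w x * f x))

  S-const : ∀ c → S (λ _ → c) ≡ W * c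
  S-const c = sym (*-distribʳ-sum c w)

  S-*-const : ∀ p {q} → (∀ x y → q x ≡ q y) → S (λ x → p x * q x) * W ≡ S p * S q
  S-*-const p {q} q-const = begin
    S (λ x → p x * q x) * W    ≡⟨ S-*ʳ _ W ⟨
    S (λ x → p x * q x * W)    ≡⟨ S-cong (λ x → trans (*-assoc (p x) (q x) W) (cong (p x *_) (q*W x))) ⟩
    S (λ x → p x * S q)        ≡⟨ S-*ʳ p (S q) ⟩
    S p * S q                  ∎
    where
    open ≡-Reasoning
    q*W : ∀ x → q x * W ≡ S q
    q*W x = trans (*-comm (q x) W) (trans (sym (S-const (q x))) (S-cong (q-const x)))

  -- The expectation under independent letters distributed as `w`, scaled by `W ^ n`. Without the
  -- division, all probability estimates are inequalities between natural numbers.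
  E : ∀ {n} → (Vec (Fin a) n → ℕ) → ℕ
  E {zero}  f = f []
  E {suc n} f = S λ x → E λ xs → f (x ∷ xs)

  E-cong : ∀ {n} {f g : Vec (Fin a) n → ℕ} → (∀ xs → f xs ≡ g xs) → E f ≡ E g
  E-cong {zero}  h = h []
  E-cong {suc n} h = S-cong λ x → E-cong λ xs → h (x ∷ xs)

  E-mono : ∀ {n} {f g : Vec (Fin a) n → ℕ} → (∀ xs → f xs ≤ g xs) → E f ≤ E g
  E-mono {zero}  h = h []
  E-mono {suc n} h = S-mono λ x → E-mono λ xs → h (x ∷ xs)

  E-+ : ∀ {n} (f g : Vec (Fin a) n → ℕ) → E (λ xs → f xs + g xs) ≡ E f + E g
  E-+ {zero}  f g = refl
  E-+ {suc n} f g = trans (S-cong λ x → E-+ (λ xs → f (x ∷ xs)) (λ xs → g (x ∷ xs))) (S-+ _ _)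

  E-const : ∀ n c → E {n} (λ _ → c) ≡ W ^ n * c
  E-const zero    c = sym (+-identityʳ c)
  E-const (suc n) c = trans (S-const _) (trans (cong (W *_) (E-const n c)) (sym (*-assoc W (W ^ n) c)))

  E>0⇒∃ : ∀ {n} (f : Vec (Fin a) n → ℕ) → 0 < E f → ∃ λ xs → 0 < f xs
  E>0⇒∃ {zero}  f h = [] , h
  E>0⇒∃ {suc n} f h with sum>0⇒∃ _ h
  ... | x , p with E>0⇒∃ (λ xs → f (x ∷ xs)) (*-cancelˡ-< (w x) 0 _ (≤-trans (s≤s (≤-reflexive (*-zeroʳ (w x)))) p))
  ...   | xs , q = x ∷ xs , q

-- Independence of functions of disjoint sets of coordinates

DependsOn : ∀ {A : Set} {n} → Pred (Fin n) 0ℓ → (Vec A n → ℕ) → Set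
DependsOn T f = ∀ xs ys → (∀ i → T i → lookup xs i ≡ lookup ys i) → f xs ≡ f ys

module _ {A : Set} {n} {T : Pred (Fin (suc n)) 0ℓ} {f : Vec A (suc n) → ℕ} where

  dependsOn-tail : DependsOn T f → ∀ x → DependsOn (T ∘ suc) (λ xs → f (x ∷ xs))
  dependsOn-tail dep x xs ys eq = dep (x ∷ xs) (x ∷ ys) λ { zero _ → refl ; (suc i) → eq i }

  dependsOn-head : DependsOn T f → ¬ T zero → ∀ x y xs → f (x ∷ xs) ≡ f (y ∷ xs)
  dependsOn-head dep ¬T₀ x y xs =
    dep (x ∷ xs) (y ∷ xs) λ { zero t → contradiction t ¬T₀ ; (suc i) _ → refl }

module _ {a} (w : Fin a → ℕ) where
  open WeightedSum w

  -- For a fixed first letter the induction hypothesis separates the tails. The first coordinate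
  -- lies in `T` or in its complement, so one of the two tail sums does not vary with it and factors
  -- out by `S-*-const`.
  E-independent : ∀ {n} {T : Pred (Fin n) 0ℓ} → Decidable T → ∀ {f g} →
    DependsOn T f → DependsOn (∁ T) g → E (λ xs → f xs * g xs) * W ^ n ≡ E f * E g
  E-independent {zero}  T? f-dep g-dep = *-identityʳ _
  E-independent {suc n} {T} T? {f} {g} f-dep g-dep = begin
    S (λ x → E λ xs → f (x ∷ xs) * g (x ∷ xs)) * (W * W ^ n)
      ≡⟨ solve 3 (λ p q r → p :* (q :* r) := (p :* r) :* q) refl (S λ x → E λ xs → f (x ∷ xs) * g (x ∷ xs)) W (W ^ n) ⟩
    S (λ x → E λ xs → f (x ∷ xs) * g (x ∷ xs)) * W ^ n * W
      ≡⟨ cong (_* W) (trans (sym (S-*ʳ _ (W ^ n))) (S-cong λ x →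
           E-independent (T? ∘ suc) (dependsOn-tail {T = T} f-dep x) (dependsOn-tail {T = ∁ T} g-dep x))) ⟩
    S (λ x → F x * G x) * W
      ≡⟨ split ⟩
    S F * S G ∎
    where
    open ≡-Reasoning
    open +-*-Solver
    F G : Fin a → ℕ
    F x = E λ xs → f (x ∷ xs)
    G x = E λ xs → g (x ∷ xs)
    split : S (λ x → F x * G x) * W ≡ S F * S G
    split with T? zero
    ... | yes t = S-*-const F λ x y → E-cong (dependsOn-head {T = ∁ T} g-dep (λ ¬t → ¬t t) x y)
    ... | no ¬t = trans (cong (_* W) (S-cong λ x → *-comm (F x) (G x)))
                  (trans (S-*-const G λ x y → E-cong (dependsOn-head {T = T} f-dep ¬t x y))
                         (*-comm (S G) (S F)))

-- Lets a bound on the number of near events pass to a filtered sublist of events.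
length-filter-filter : ∀ {A : Set} {P Q : Pred A 0ℓ} (P? : Decidable P) (Q? : Decidable Q) L →
  length (filter P? (filter Q? L)) ≤ length (filter P? L)
length-filter-filter P? Q? [] = z≤n
length-filter-filter P? Q? (v ∷ L) with does (Q? v)
length-filter-filter P? Q? (v ∷ L) | true with does (P? v)
... | true  = s≤s (length-filter-filter P? Q? L)
... | false = length-filter-filter P? Q? L
length-filter-filter P? Q? (v ∷ L) | false with does (P? v)
... | true  = m≤n⇒m≤1+n (length-filter-filter P? Q? L)
... | false = length-filter-filter P? Q? L

-- The Lovász Local Lemma

module LocalLemma {a n N} (w : Fin a → ℕ) (bad : Fin N → Vec (Fin a) n → ℕ)
  (bad≤1 : ∀ v xs → bad v xs ≤ 1)
  {T : Fin N → Pred (Fin n) 0ℓ} (T? : ∀ v → Decidable (T v))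
  (bad-dep : ∀ v → DependsOn (T v) (bad v))
  where
  open WeightedSum w

  -- Adjacency in the dependency graph of the events; an event with inhabited `T v` is near itself.
  Near : Fin N → Fin N → Set
  Near v u = ∃ λ i → T v i × T u i

  near? : ∀ v → Decidable (Near v)
  near? v u = Fin.any? λ i → T? v i ×-dec T? u i

  good : List (Fin N) → Vec (Fin a) n → ℕ
  good []      xs = 1
  good (v ∷ L) xs = (1 ∸ bad v xs) * good L xs

  -- Counts the events that occur instead of testing for one, so that the union bound becomes
  -- additivity of `E`.
  anyBad : List (Fin N) → Vec (Fin a) n → ℕ
  anyBad []      xs = 0
  anyBad (v ∷ L) xs = bad v xs + anyBad L xs

  good-split : ∀ v L xs → good L xs ≡ good (v ∷ L) xs + bad v xs * good L xs
  good-split v L xs = begin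
    good L xs                                   ≡⟨ *-identityˡ _ ⟨
    1 * good L xs                               ≡⟨ cong (_* good L xs) (m∸n+n≡m (bad≤1 v xs)) ⟨
    (1 ∸ bad v xs + bad v xs) * good L xs       ≡⟨ *-distribʳ-+ (good L xs) (1 ∸ bad v xs) (bad v xs) ⟩
    (1 ∸ bad v xs) * good L xs + bad v xs * good L xs ∎
    where open ≡-Reasoning

  module _ {P : Pred (Fin N) 0ℓ} (P? : Decidable P) where

    good-filter-≥ : ∀ L xs → good L xs ≤ good (filter P? L) xs
    good-filter-≥ []      xs = ≤-refl
    good-filter-≥ (v ∷ L) xs with P? v
    ... | yes _ = *-monoʳ-≤ (1 ∸ bad v xs) (good-filter-≥ L xs)
    ... | no  _ = ≤-trans (*-monoˡ-≤ (good L xs) (m∸n≤m 1 (bad v xs)))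
                  (≤-trans (≤-reflexive (*-identityˡ _)) (good-filter-≥ L xs))

    -- The union bound over the events removed by the filter.
    good-filter-≤ : ∀ L xs → let L′ = filter (∁? P?) L in
      good L′ xs ≤ good L xs + anyBad (filter P? L) xs * good L′ xs
    good-filter-≤ []      xs = ≤-refl
    good-filter-≤ (v ∷ L) xs with P? v
    ... | no  _ = begin
      c * g′                  ≤⟨ *-monoʳ-≤ c (good-filter-≤ L xs) ⟩
      c * (good L xs + B * g′) ≡⟨ solve 4 (λ c g b h → c :* (g :+ b :* h) := c :* g :+ b :* (c :* h)) refl c (good L xs) B g′ ⟩
      c * good L xs + B * (c * g′) ∎
      where
      open ≤-Reasoning
      open +-*-Solver
      c = 1 ∸ bad v xs
      g′ = good (filter (∁? P?) L) xs
      B = anyBad (filter P? L) xs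
    ... | yes _ = begin
      g′                                       ≡⟨ good-split v (filter (∁? P?) L) xs ⟩
      c * g′ + b * g′                          ≤⟨ +-monoˡ-≤ (b * g′) (*-monoʳ-≤ c (good-filter-≤ L xs)) ⟩
      c * (good L xs + B * g′) + b * g′        ≡⟨ cong (_+ b * g′) (*-distribˡ-+ c (good L xs) (B * g′)) ⟩
      c * good L xs + c * (B * g′) + b * g′    ≤⟨ +-monoˡ-≤ (b * g′) (+-monoʳ-≤ (c * good L xs) (*-monoˡ-≤ (B * g′) (m∸n≤m 1 b))) ⟩
      c * good L xs + 1 * (B * g′) + b * g′    ≡⟨ solve 4 (λ x b B g → x :+ con 1 :* (B :* g) :+ b :* g := x :+ (b :+ B) :* g) refl (c * good L xs) b B g′ ⟩
      c * good L xs + (b + B) * g′             ∎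
      where
      open ≤-Reasoning
      open +-*-Solver
      b = bad v xs
      c = 1 ∸ b
      g′ = good (filter (∁? P?) L) xs
      B = anyBad (filter P? L) xs

  good-dep : ∀ {P : Pred (Fin n) 0ℓ} L → All (λ u → ∀ i → T u i → P i) L → DependsOn P (good L)
  good-dep []      []        xs ys eq = refl
  good-dep (u ∷ L) (T⊆P ∷ h) xs ys eq =
    cong₂ (λ b g → (1 ∸ b) * g) (bad-dep u xs ys λ i t → eq i (T⊆P i t)) (good-dep L h xs ys eq)

  good>0⇒avoids : ∀ L xs → 0 < good L xs → ∀ {v} → v ∈ L → bad v xs ≡ 0
  good>0⇒avoids (u ∷ L) xs h (Any.here refl) with bad u xs
  ... | zero  = refl
  good>0⇒avoids (u ∷ L) xs () (Any.here refl) | suc zero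
  good>0⇒avoids (u ∷ L) xs () (Any.here refl) | suc (suc _)
  good>0⇒avoids (u ∷ L) xs h (Any.there v∈L) =
    good>0⇒avoids L xs (m*n>0⇒n>0 (1 ∸ bad u xs) h) v∈L
    where
    m*n>0⇒n>0 : ∀ m {n} → 0 < m * n → 0 < n
    m*n>0⇒n>0 m {zero}  p = subst (0 <_) (*-zeroʳ m) p
    m*n>0⇒n>0 m {suc n} p = s≤s z≤n

  -- With `g` as conditioning weight, the hypothesis bounds each conditional probability by 1/`q`,
  -- and additivity of `E` sums these bounds.
  anyBad-bound : ∀ q L (g : Vec (Fin a) n → ℕ) →
    All (λ u → q * E (λ xs → bad u xs * g xs) ≤ E g) L →
    q * E (λ xs → anyBad L xs * g xs) ≤ length L * E g
  anyBad-bound q []  g [] =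
    ≤-reflexive (trans (cong (q *_) (trans (E-const n 0) (*-zeroʳ (W ^ n)))) (*-zeroʳ q))
  anyBad-bound q (u ∷ L) g (p ∷ ps) = begin
    q * E (λ xs → (bad u xs + anyBad L xs) * g xs)
      ≡⟨ cong (q *_) (trans (E-cong λ xs → *-distribʳ-+ (g xs) (bad u xs) (anyBad L xs)) (E-+ (λ xs → bad u xs * g xs) _)) ⟩
    q * (E (λ xs → bad u xs * g xs) + E (λ xs → anyBad L xs * g xs))
      ≡⟨ *-distribˡ-+ q _ _ ⟩
    q * E (λ xs → bad u xs * g xs) + q * E (λ xs → anyBad L xs * g xs)
      ≤⟨ +-mono-≤ p (anyBad-bound q L g ps) ⟩
    E g + length L * E g ∎
    where open ≤-Reasoning

  module _ {q} (2≤q : 2 ≤ q) (W>0 : 0 < W)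
    (bad-small : ∀ v → 2 * q * E (bad v) ≤ W ^ n)
    where

    private instance
      q≢0 : NonZero q
      q≢0 = >-nonZero (≤-trans (s≤s z≤n) 2≤q)
      Wⁿ≢0 : NonZero (W ^ n)
      Wⁿ≢0 = m^n≢0 W n {{>-nonZero W>0}}

    -- One half of the symmetric condition 4ps ≤ 1: `bad-small` gives each event probability p ≤
    -- 1/(2q), and here the number s of near events is at most q/2.
    Sparse : List (Fin N) → Set
    Sparse L = ∀ v → 2 * length (filter (near? v) L) ≤ q

    -- Dropping the events near v makes the rest independent of v; by the union
    -- bound and the induction hypothesis this at most doubles the good weight.
    bad-good-bound : ∀ ℓ L → length L ≤ ℓ → Sparse L → ∀ v →
      q * E (λ xs → bad v xs * good L xs) ≤ E (good L)
    bad-good-bound ℓ L len sparse v = *-cancelˡ-≤ (2 * W ^ n) {{m*n≢0 2 (W ^ n)}} (begin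
      2 * W ^ n * (q * E (λ xs → bad v xs * good L xs))
        ≤⟨ *-monoʳ-≤ (2 * W ^ n) (*-monoʳ-≤ q (E-mono λ xs → *-monoʳ-≤ (bad v xs) (good-filter-≥ far? L xs))) ⟩
      2 * W ^ n * (q * E (λ xs → bad v xs * good L′ xs))
        ≡⟨ solve 3 (λ w q e → con 2 :* w :* (q :* e) := con 2 :* q :* (e :* w)) refl (W ^ n) q _ ⟩
      2 * q * (E (λ xs → bad v xs * good L′ xs) * W ^ n)
        ≡⟨ cong (2 * q *_) (E-independent w (T? v) (bad-dep v) (good-dep L′ (All.map (λ ¬near i t t′ → ¬near (i , t′ , t)) (all-filter far? L)))) ⟩
      2 * q * (E (bad v) * E (good L′))
        ≡⟨ *-assoc (2 * q) _ _ ⟨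
      2 * q * E (bad v) * E (good L′)
        ≤⟨ *-mono-≤ (bad-small v) E-good-L′ ⟩
      W ^ n * (2 * E (good L))
        ≡⟨ solve 2 (λ w e → w :* (con 2 :* e) := con 2 :* w :* e) refl (W ^ n) _ ⟩
      2 * W ^ n * E (good L) ∎)
      where
      open ≤-Reasoning
      open +-*-Solver
      far? : Decidable (∁ (Near v))
      far? = ∁? (near? v)
      L′ F : List (Fin N)
      L′ = filter far? L
      F = filter (near? v) L

      recurse : ∀ ℓ → length L ≤ ℓ → ∀ {u} → u ∈ F → q * E (λ xs → bad u xs * good L′ xs) ≤ E (good L′)
      recurse ℓ len {u} u∈F with ∈-filter⁻ (near? v) {xs = L} u∈F
      -- `u` lies in `L` and is near `v`, so it is missing from `L′`, which is therefore strictly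
      -- shorter. This lets the length bound `ℓ` decrease in the recursion.
      ... | u∈L , near with ≤-trans (filter-notAll far? L (Any.map (λ { refl far → far near }) u∈L)) len
      recurse (suc ℓ) len {u} u∈F | u∈L , near | s≤s len′ =
        bad-good-bound ℓ L′ len′ (λ v′ → ≤-trans (*-monoʳ-≤ 2 (length-filter-filter (near? v′) far? L)) (sparse v′)) u

      E-good-L′ : E (good L′) ≤ 2 * E (good L)
      -- There are two copies of `q * e′` on the left. Since `2 * length F ≤ q`, the union bound
      -- over the removed events costs at most one copy, and cancelling it leaves
      -- `q * e′ ≤ q * (2 * e)`.
      E-good-L′ = *-cancelˡ-≤ q (+-cancelʳ-≤ (q * e′) (q * e′) (q * (2 * e)) (begin
        q * e′ + q * e′
          ≡⟨ solve 2 (λ q x → q :* x :+ q :* x := con 2 :* (q :* x)) refl q e′ ⟩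
        2 * (q * e′)
          ≤⟨ *-monoʳ-≤ 2 (*-monoʳ-≤ q (≤-trans (E-mono (good-filter-≤ (near? v) L)) (≤-reflexive (E-+ (good L) _)))) ⟩
        2 * (q * (e + E (λ xs → anyBad F xs * good L′ xs)))
          ≡⟨ cong (2 *_) (*-distribˡ-+ q e _) ⟩
        2 * (q * e + q * E (λ xs → anyBad F xs * good L′ xs))
          ≤⟨ *-monoʳ-≤ 2 (+-monoʳ-≤ (q * e) (anyBad-bound q F (good L′) (All.tabulate (recurse ℓ len)))) ⟩
        2 * (q * e + length F * e′)
          ≡⟨ solve 4 (λ q e f x → con 2 :* (q :* e :+ f :* x) := q :* (con 2 :* e) :+ con 2 :* f :* x) refl q e (length F) e′ ⟩
        q * (2 * e) + 2 * length F * e′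
          ≤⟨ +-monoʳ-≤ (q * (2 * e)) (*-monoˡ-≤ e′ (sparse v)) ⟩
        q * (2 * e) + q * e′ ∎))
        where
        e = E (good L)
        e′ = E (good L′)

    -- By `good-split`, if no weight were left after adding `v`, all of `E (good L)` would lie on
    -- `bad v`. But `bad v` carries at most 1/`q` of it and `2 ≤ q`, so `E (good L)` would vanish as
    -- well.
    E-good>0 : ∀ L → Sparse L → 0 < E (good L)
    E-good>0 [] _ = subst (0 <_) (sym (trans (E-const n 1) (*-identityʳ _))) (m^n>0 W {{>-nonZero W>0}} n)
    E-good>0 (v ∷ L) sparse = ≰⇒> λ E≤0 → <⇒≱ (E-good>0 L sparse′) (+-cancelˡ-≤ (E (good L)) (E (good L)) 0 (begin
      E (good L) + E (good L)
        ≡⟨ solve 1 (λ x → x :+ x := con 2 :* x) refl (E (good L)) ⟩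
      2 * E (good L)
        ≤⟨ *-monoˡ-≤ (E (good L)) 2≤q ⟩
      q * E (good L)
        ≡⟨ cong (q *_) (trans (E-cong (good-split v L)) (E-+ (good (v ∷ L)) _)) ⟩
      q * (E (good (v ∷ L)) + E (λ xs → bad v xs * good L xs))
        ≡⟨ cong (λ z → q * (z + E (λ xs → bad v xs * good L xs))) (n≤0⇒n≡0 E≤0) ⟩
      q * E (λ xs → bad v xs * good L xs)
        ≤⟨ bad-good-bound (length L) L ≤-refl sparse′ v ⟩
      E (good L)
        ≡⟨ +-identityʳ _ ⟨
      E (good L) + 0 ∎))
      where
      open ≤-Reasoning
      open +-*-Solver
      sparse′ : Sparse L
      sparse′ u = ≤-trans (*-monoʳ-≤ 2 shorter) (sparse u)
        where
        shorter : length (filter (near? u) L) ≤ length (filter (near? u) (v ∷ L))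
        shorter with does (near? u v)
        ... | true  = n≤1+n _
        ... | false = ≤-refl

    local-lemma : Sparse (allFin N) → ∃ λ xs → ∀ v → bad v xs ≡ 0
    local-lemma sparse with E>0⇒∃ (good (allFin N)) (E-good>0 (allFin N) sparse)
    ... | xs , good>0 = xs , λ v → good>0⇒avoids (allFin N) xs good>0 (∈-allFin v)

-- Indicators and counting

𝟙 : {P : Set} → Dec P → ℕ
𝟙 d = if does d then 1 else 0

𝟙-mono : {P Q : Set} (p : Dec P) (q : Dec Q) → (P → Q) → 𝟙 p ≤ 𝟙 q
𝟙-mono (no _)  q       f = z≤n
𝟙-mono (yes p) (yes _) f = ≤-refl
𝟙-mono (yes p) (no ¬q) f = contradiction (f p) ¬q

𝟙-cong : {P Q : Set} (p : Dec P) (q : Dec Q) → (P → Q) → (Q → P) → 𝟙 p ≡ 𝟙 q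
𝟙-cong p q f g = ≤-antisym (𝟙-mono p q f) (𝟙-mono q p g)

count : ∀ {n} {P : Pred (Fin n) 0ℓ} → Decidable P → ℕ
count P? = sum λ i → 𝟙 (P? i)

length-filter-tabulate : ∀ {A : Set} {P : Pred A 0ℓ} (P? : Decidable P) {n} (f : Fin n → A) →
  length (filter P? (List.tabulate f)) ≡ count (λ i → P? (f i))
length-filter-tabulate P? {zero}  f = refl
length-filter-tabulate P? {suc n} f with does (P? (f zero))
... | true  = cong suc (length-filter-tabulate P? (f ∘ suc))
... | false = length-filter-tabulate P? (f ∘ suc)

count≡0⇒¬ : ∀ {n} {P : Pred (Fin n) 0ℓ} (P? : Decidable P) → count P? ≡ 0 → ∀ i → ¬ P i
count≡0⇒¬ P? eq zero    p with P? zero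
... | no ¬p = ¬p p
count≡0⇒¬ P? eq (suc i) p = count≡0⇒¬ (P? ∘ suc) (m+n≡0⇒n≡0 (𝟙 (P? zero)) eq) i p

count≡1⇒∃! : ∀ {n} {P : Pred (Fin n) 0ℓ} (P? : Decidable P) → count P? ≡ 1 → ∃! _≡_ P
count≡1⇒∃! {suc n} {P} P? eq with P? zero
... | yes p = zero , p , unique
  where
  unique : ∀ {y} → P y → zero ≡ y
  unique {zero}  _ = refl
  unique {suc y} q = contradiction q (count≡0⇒¬ (P? ∘ suc) (suc-injective eq) y)
... | no ¬p with count≡1⇒∃! (P? ∘ suc) eq
...   | i , p , unq = suc i , p , unique
  where
  unique : ∀ {y} → P y → suc i ≡ y
  unique {zero}  q = contradiction q ¬p
  unique {suc y} q = cong suc (unq q)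

count-≡ : ∀ {n} (v : Fin n) → count (Fin._≟ v) ≡ 1
count-≡ {suc n} zero    = cong suc (sum-replicate-zero n)
count-≡ {suc n} (suc v) = count-≡ v

-- The weight of the colourings without a unique colour

notOne : ℕ → ℕ
notOne 1 = 0
notOne _ = 1

notOne≤1 : ∀ s → notOne s ≤ 1
notOne≤1 zero          = ≤-refl
notOne≤1 (suc zero)    = z≤n
notOne≤1 (suc (suc s)) = ≤-refl

notOne≡0⇒≡1 : ∀ {s} → notOne s ≡ 0 → s ≡ 1
notOne≡0⇒≡1 {suc zero} _ = refl

∏≤1 : ∀ {k} {f : Fin k → ℕ} → (∀ i → f i ≤ 1) → ∏ f ≤ 1
∏≤1 {zero}  h = ≤-refl
∏≤1 {suc k} h = *-mono-≤ (h zero) (∏≤1 (h ∘ suc))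

∏≡0⇒∃ : ∀ {k} (f : Fin k → ℕ) → ∏ f ≡ 0 → ∃ λ i → f i ≡ 0
∏≡0⇒∃ {suc k} f eq with m*n≡0⇒m≡0∨n≡0 (f zero) eq
... | inj₁ f₀≡0 = zero , f₀≡0
... | inj₂ rest = let i , p = ∏≡0⇒∃ (f ∘ suc) rest in suc i , p

∏-const : ∀ k c → ∏ {k} (λ _ → c) ≡ c ^ k
∏-const zero    c = refl
∏-const (suc k) c = cong (c *_) (∏-const k c)

module _ {n k : ℕ} {T : Pred (Fin n) 0ℓ} (T? : Decidable T) where

  -- Letter `zero` is the blank and is never counted; proper colour `i` is the letter `suc i`.
  occurrences : Vec (Fin (suc k)) n → Fin k → ℕ
  occurrences xs i = count λ w → T? w ×-dec lookup xs w Fin.≟ suc i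

  -- The offset s records the occurrences seen before the vector starts.
  noUnique : (Fin k → ℕ) → Vec (Fin (suc k)) n → ℕ
  noUnique s xs = ∏ λ i → notOne (s i + occurrences xs i)

  noUnique-dep : ∀ s → DependsOn T (noUnique s)
  noUnique-dep s xs ys eq = ∏-cong λ i → cong (λ c → notOne (s i + c)) (sum-cong-≗ λ w →
    𝟙-cong (T? w ×-dec lookup xs w Fin.≟ suc i) (T? w ×-dec lookup ys w Fin.≟ suc i)
      (λ { (t , p) → t , trans (sym (eq w t)) p }) (λ { (t , p) → t , trans (eq w t) p }))

  noUnique≤1 : ∀ s xs → noUnique s xs ≤ 1
  noUnique≤1 s xs = ∏≤1 λ i → notOne≤1 (s i + occurrences xs i)

  noUnique≡0⇒∃! : ∀ xs → noUnique (λ _ → 0) xs ≡ 0 → ∃ λ i → ∃! _≡_ λ w → T w × lookup xs w ≡ suc i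
  noUnique≡0⇒∃! xs eq with ∏≡0⇒∃ (λ i → notOne (occurrences xs i)) eq
  ... | i , once = i , count≡1⇒∃! (λ w → T? w ×-dec lookup xs w Fin.≟ suc i) (notOne≡0⇒≡1 once)

-- Only the terms of degree at most one of the expanded product are kept.
∏-linear-part : ∀ m k (c : Fin k → ℕ → ℕ) →
  m ^ k * (m * ∏ (λ i → c i 0) + sum (λ j → ∏ λ i → c i (𝟙 (j Fin.≟ i)))) ≤
  m * ∏ (λ i → m * c i 0 + c i 1)
∏-linear-part m zero    c = ≤-reflexive (trans (*-identityˡ _) (+-identityʳ _))
∏-linear-part m (suc k) c = begin
  m * m ^ k * (m * (a * A) + (b * A + sum (λ j → a * B j)))
    ≡⟨ cong (λ z → m * m ^ k * (m * (a * A) + (b * A + z))) (*-distribˡ-sum a B) ⟨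
  m * m ^ k * (m * (a * A) + (b * A + a * sum B))
    ≡⟨ solve 6 (λ m p a A b t → m :* p :* (m :* (a :* A) :+ (b :* A :+ a :* t)) :=
         m :* a :* (p :* (m :* A :+ t)) :+ b :* (p :* (m :* A))) refl m (m ^ k) a A b (sum B) ⟩
  m * a * (m ^ k * (m * A + sum B)) + b * (m ^ k * (m * A))
    ≤⟨ +-mono-≤ (*-monoʳ-≤ (m * a) ih) (*-monoʳ-≤ b (≤-trans (*-monoʳ-≤ (m ^ k) (m≤m+n (m * A) (sum B))) ih)) ⟩
  m * a * (m * R) + b * (m * R)
    ≡⟨ solve 4 (λ m a b r → m :* a :* (m :* r) :+ b :* (m :* r) := m :* ((m :* a :+ b) :* r)) refl m a b R ⟩
  m * ((m * a + b) * R) ∎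
  where
  open ≤-Reasoning
  open +-*-Solver
  a = c zero 0
  b = c zero 1
  A = ∏ λ i → c (suc i) 0
  B : Fin k → ℕ
  B j = ∏ λ i → c (suc i) (𝟙 (j Fin.≟ i))
  R = ∏ λ i → m * c (suc i) 0 + c (suc i) 1
  ih : m ^ k * (m * A + sum B) ≤ m * R
  ih = ∏-linear-part m k (c ∘ suc)

-- avoid m L s is the weight of the words of length L over a letter of weight 1
-- and a blank of weight m in which s + (number of letters) ≠ 1.
avoid : ℕ → ℕ → ℕ → ℕ
avoid m zero    s = notOne s
avoid m (suc L) s = m * avoid m L s + avoid m L (suc s)

avoid-≥2 : ∀ m L s → avoid m L (2 + s) ≡ (1 + m) ^ L
avoid-≥2 m zero    s = refl
avoid-≥2 m (suc L) s = begin
  m * avoid m L (2 + s) + avoid m L (3 + s) ≡⟨ cong₂ (λ x y → m * x + y) (avoid-≥2 m L s) (avoid-≥2 m L (suc s)) ⟩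
  m * (1 + m) ^ L + (1 + m) ^ L             ≡⟨ +-comm (m * (1 + m) ^ L) _ ⟩
  (1 + m) ^ suc L                           ∎
  where open ≡-Reasoning

-- With one letter already seen, the only excluded word is the all-blank one, of weight `m ^ L`.
avoid-1 : ∀ m L → avoid m L 1 + m ^ L ≡ (1 + m) ^ L
avoid-1 m zero    = refl
avoid-1 m (suc L) = begin
  m * avoid m L 1 + avoid m L 2 + m * m ^ L   ≡⟨ cong (λ z → m * avoid m L 1 + z + m * m ^ L) (avoid-≥2 m L 0) ⟩
  m * avoid m L 1 + (1 + m) ^ L + m * m ^ L   ≡⟨ solve 4 (λ m x y z → m :* x :+ y :+ m :* z := y :+ m :* (x :+ z)) refl m (avoid m L 1) ((1 + m) ^ L) (m ^ L) ⟩
  (1 + m) ^ L + m * (avoid m L 1 + m ^ L)     ≡⟨ cong (λ z → (1 + m) ^ L + m * z) (avoid-1 m L) ⟩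
  (1 + m) ^ suc L                             ∎
  where
  open ≡-Reasoning
  open +-*-Solver

-- The excluded words have a single letter in one of `L` places, and each has weight m^(L-1).
-- Multiplying through by `m` avoids the exponent L - 1.
avoid-0 : ∀ m L → m * avoid m L 0 + L * m ^ L ≡ m * (1 + m) ^ L
avoid-0 m zero    = +-identityʳ _
avoid-0 m (suc L) = begin
  m * (m * avoid m L 0 + avoid m L 1) + (m ^ suc L + L * m ^ suc L)
    ≡⟨ solve 5 (λ m x y p l → m :* (m :* x :+ y) :+ (m :* p :+ l :* (m :* p)) := m :* (m :* x :+ l :* p) :+ m :* (y :+ p))
         refl m (avoid m L 0) (avoid m L 1) (m ^ L) L ⟩
  m * (m * avoid m L 0 + L * m ^ L) + m * (avoid m L 1 + m ^ L)
    ≡⟨ cong₂ (λ x y → m * x + m * y) (avoid-0 m L) (avoid-1 m L) ⟩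
  m * (m * (1 + m) ^ L) + m * (1 + m) ^ L
    ≡⟨ solve 2 (λ m x → m :* (m :* x) :+ m :* x := m :* ((con 1 :+ m) :* x)) refl m ((1 + m) ^ L) ⟩
  m * (1 + m) ^ suc L ∎
  where
  open ≡-Reasoning
  open +-*-Solver

weight : ∀ m {k} → Fin (suc k) → ℕ
weight m zero    = m
weight m (suc _) = 1

sum-1 : ∀ n → sum {n} (λ _ → 1) ≡ n
sum-1 zero    = refl
sum-1 (suc n) = cong suc (sum-1 n)

total-weight : ∀ m k → sum (weight m {k}) ≡ m + k
total-weight m k = cong (_+_ m) (sum-1 k)

module _ (m k : ℕ) where
  open WeightedSum (weight m {k})

  S-weight : ∀ f → S f ≡ m * f zero + sum (f ∘ suc)
  S-weight f = cong (_+_ (m * f zero)) (sum-cong-≗ λ i → *-identityˡ (f (suc i)))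

  -- Replaces the proper colours, of which a vertex gets at most one, by
  -- independent ones (see ∏-linear-part for a single vertex).
  E-noUnique : ∀ {n} {T : Pred (Fin n) 0ℓ} (T? : Decidable T) (s : Fin k → ℕ) →
    E (noUnique T? s) * (m ^ k * (m + k)) ^ count T? ≤
    m ^ count T? * (m + k) ^ n * ∏ (λ i → avoid m (count T?) (s i))
  E-noUnique {zero}  T? s = ≤-reflexive (begin
    ∏ (λ i → notOne (s i + 0)) * 1   ≡⟨ *-identityʳ _ ⟩
    ∏ (λ i → notOne (s i + 0))       ≡⟨ ∏-cong (λ i → cong notOne (+-identityʳ (s i))) ⟩
    ∏ (λ i → notOne (s i))           ≡⟨ *-identityˡ _ ⟨
    1 * ∏ (λ i → notOne (s i))       ∎)
    where open ≡-Reasoning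
  E-noUnique {suc n} T? s with T? zero
  ... | no _ = begin
    S (λ _ → E f) * Y                 ≡⟨ cong (_* Y) (trans (S-const (E f)) (cong (_* E f) (total-weight m k))) ⟩
    (m + k) * E f * Y                 ≡⟨ *-assoc (m + k) (E f) Y ⟩
    (m + k) * (E f * Y)               ≤⟨ *-monoʳ-≤ (m + k) (E-noUnique (T? ∘ suc) s) ⟩
    (m + k) * (m ^ D * (m + k) ^ n * R) ≡⟨ solve 4 (λ w p q r → w :* (p :* q :* r) := p :* (w :* q) :* r) refl (m + k) (m ^ D) ((m + k) ^ n) R ⟩
    m ^ D * ((m + k) * (m + k) ^ n) * R ∎
    where
    open ≤-Reasoning
    open +-*-Solver
    D = count (T? ∘ suc)
    Y = (m ^ k * (m + k)) ^ D
    R = ∏ λ i → avoid m D (s i)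
    f = noUnique (T? ∘ suc) s
  ... | yes _ = begin
    S e * (m ^ k * (m + k) * Y)
      ≡⟨ solve 4 (λ e p w y → e :* (p :* w :* y) := p :* w :* (e :* y)) refl (S e) (m ^ k) (m + k) Y ⟩
    m ^ k * (m + k) * (S e * Y)
      ≡⟨ cong (m ^ k * (m + k) *_) (S-*ʳ e Y) ⟨
    m ^ k * (m + k) * S (λ x → e x * Y)
      -- A head letter `suc j` raises the offset of colour `j` by one, and the blank raises none. So
      -- `R zero` and `R ∘ suc` are the constant and linear terms to which `∏-linear-part` applies.
      ≤⟨ *-monoʳ-≤ (m ^ k * (m + k)) (S-mono bound) ⟩
    m ^ k * (m + k) * S (λ x → R x * Z)
      ≡⟨ cong (m ^ k * (m + k) *_) (trans (S-*ʳ R Z) (cong (_* Z) (S-weight R))) ⟩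
    m ^ k * (m + k) * ((m * R zero + sum (R ∘ suc)) * Z)
      ≡⟨ solve 4 (λ p w r z → p :* w :* (r :* z) := w :* z :* (p :* r)) refl (m ^ k) (m + k) (m * R zero + sum (R ∘ suc)) Z ⟩
    (m + k) * Z * (m ^ k * (m * R zero + sum (R ∘ suc)))
      ≤⟨ *-monoʳ-≤ ((m + k) * Z) linear ⟩
    (m + k) * Z * (m * Q)
      ≡⟨ solve 5 (λ w p q m r → w :* (p :* q) :* (m :* r) := m :* p :* (w :* q) :* r) refl (m + k) (m ^ D) ((m + k) ^ n) m Q ⟩
    m * m ^ D * ((m + k) * (m + k) ^ n) * Q ∎
    where
    open ≤-Reasoning
    open +-*-Solver
    D = count (T? ∘ suc)
    Y = (m ^ k * (m + k)) ^ D
    Z = m ^ D * (m + k) ^ n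
    Q = ∏ λ i → m * avoid m D (s i) + avoid m D (suc (s i))
    hit : Fin (suc k) → Fin k → ℕ
    hit x i = 𝟙 (x Fin.≟ suc i)
    e R : Fin (suc k) → ℕ
    e x = E λ xs → ∏ λ i → notOne (s i + (hit x i + occurrences (T? ∘ suc) xs i))
    R x = ∏ λ i → avoid m D (s i + hit x i)
    bound : ∀ x → e x * Y ≤ R x * Z
    bound x = begin
      e x * Y
        ≡⟨ cong (_* Y) (E-cong λ xs → ∏-cong λ i →
             cong notOne (sym (+-assoc (s i) (hit x i) (occurrences (T? ∘ suc) xs i)))) ⟩
      E (noUnique (T? ∘ suc) (λ i → s i + hit x i)) * Y
        ≤⟨ E-noUnique (T? ∘ suc) (λ i → s i + hit x i) ⟩
      Z * R x
        ≡⟨ *-comm Z (R x) ⟩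
      R x * Z ∎
    linear : m ^ k * (m * R zero + sum (R ∘ suc)) ≤ m * Q
    linear = ≤-trans (∏-linear-part m k λ i h → avoid m D (s i + h))
      (≤-reflexive (cong (m *_) (∏-cong λ i → cong₂ (λ x y → m * avoid m D x + avoid m D y) (+-identityʳ (s i)) (+-comm (s i) 1))))

-- Numerical estimates

-- Bernoulli's inequality (1 - x)^j ≥ 1 - jx at x = d/(c + d), cleared of denominators.
bernoulli : ∀ c d j → (c + d) ^ suc j ≤ c ^ j * (c + d) + j * d * (c + d) ^ j
bernoulli c d zero    = ≤-reflexive (solve 2 (λ c d → (c :+ d) :* con 1 := con 1 :* (c :+ d) :+ con 0) refl c d)
  where open +-*-Solver
bernoulli c d (suc j) = begin
  (c + d) * (Y * y)
    ≡⟨ solve 3 (λ c d z → (c :+ d) :* z := c :* z :+ d :* z) refl c d (Y * y) ⟩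
  c * (Y * y) + d * (Y * y)
    ≤⟨ +-monoˡ-≤ (d * (Y * y)) (*-monoʳ-≤ c (bernoulli c d j)) ⟩
  c * (c ^ j * Y + j * d * y) + d * (Y * y)
    ≡⟨ solve 6 (λ c p Y j d y → c :* (p :* Y :+ j :* d :* y) :+ d :* (Y :* y) :=
         (c :* p :* Y :+ d :* (Y :* y)) :+ j :* d :* y :* c) refl c (c ^ j) Y j d y ⟩
  (c * c ^ j * Y + d * (Y * y)) + j * d * y * c
    ≤⟨ +-monoʳ-≤ (c * c ^ j * Y + d * (Y * y)) (*-monoʳ-≤ (j * d * y) (m≤m+n c d)) ⟩
  (c * c ^ j * Y + d * (Y * y)) + j * d * y * Y
    ≡⟨ solve 5 (λ p Y d y j → (p :* Y :+ d :* (Y :* y)) :+ j :* d :* y :* Y :=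
         p :* Y :+ (con 1 :+ j) :* d :* (Y :* y)) refl (c * c ^ j) Y d y j ⟩
  c * c ^ j * Y + suc j * d * (Y * y) ∎
  where
  open ≤-Reasoning
  open +-*-Solver
  Y = c + d
  y = (c + d) ^ j

-- The hypothesis makes jd/(c + d) at most 1/2, so `bernoulli` leaves at least 1/2 for (c/(c +
-- d))^j.
[c+d]^j≤2c^j : ∀ c d j → .{{NonZero c}} → 2 * (j * d) ≤ c → (c + d) ^ j ≤ 2 * c ^ j
[c+d]^j≤2c^j c d j small = *-cancelˡ-≤ Y {{>-nonZero (≤-trans (>-nonZero⁻¹ c) (m≤m+n c d))}}
  (+-cancelʳ-≤ (Y * y) (Y * y) (Y * (2 * c ^ j)) (begin
  Y * y + Y * y
    ≡⟨ solve 1 (λ z → z :+ z := con 2 :* z) refl (Y * y) ⟩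
  2 * (Y * y)
    ≤⟨ *-monoʳ-≤ 2 (bernoulli c d j) ⟩
  2 * (c ^ j * Y + j * d * y)
    ≡⟨ solve 4 (λ p Y z y → con 2 :* (p :* Y :+ z :* y) := Y :* (con 2 :* p) :+ con 2 :* z :* y) refl (c ^ j) Y (j * d) y ⟩
  Y * (2 * c ^ j) + 2 * (j * d) * y
    ≤⟨ +-monoʳ-≤ (Y * (2 * c ^ j)) (*-monoˡ-≤ y (≤-trans small (m≤m+n c d))) ⟩
  Y * (2 * c ^ j) + Y * y ∎))
  where
  open ≤-Reasoning
  open +-*-Solver
  Y = c + d
  y = (c + d) ^ j

-- (1 + 1/m)^i ≤ (1 + i/m) (1 + k/m²)^i for i ≤ k, cleared of denominators.
[1+m]^i-≤ : ∀ m k i → i ≤ k → (1 + m) ^ i * m * (m * m) ^ i ≤ m ^ i * (m + i) * (m * m + k) ^ i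
[1+m]^i-≤ m k zero    _   = ≤-reflexive (solve 1 (λ m → con 1 :* m :* con 1 := con 1 :* (m :+ con 0) :* con 1) refl m)
  where open +-*-Solver
[1+m]^i-≤ m k (suc i) i<k = *-cancelˡ-≤ (suc (m + i)) (begin
  suc (m + i) * ((1 + m) * p * m * (m * m * q))
    ≡⟨ solve 4 (λ m i p q → (con 1 :+ (m :+ i)) :* ((con 1 :+ m) :* p :* m :* (m :* m :* q)) :=
         (con 1 :+ (m :+ i)) :* (con 1 :+ m) :* (m :* m) :* (p :* m :* q)) refl m i p q ⟩
  suc (m + i) * (1 + m) * (m * m) * (p * m * q)
    ≤⟨ *-monoʳ-≤ (suc (m + i) * (1 + m) * (m * m)) ([1+m]^i-≤ m k i (<⇒≤ i<k)) ⟩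
  suc (m + i) * (1 + m) * (m * m) * (m ^ i * (m + i) * Q)
    ≡⟨ solve 4 (λ m i p q → (con 1 :+ (m :+ i)) :* (con 1 :+ m) :* (m :* m) :* (p :* (m :+ i) :* q) :=
         (con 1 :+ (m :+ i)) :* p :* q :* m :* (m :* (m :* (m :+ i :+ con 1) :+ i))) refl m i (m ^ i) Q ⟩
  suc (m + i) * m ^ i * Q * m * (m * (m * (m + i + 1) + i))
    -- Here (m + i)(1 + m) has been rewritten as m(m + i + 1) + i. The error term `i` is absorbed by
    -- the factor `m * m + k`, because `i` is at most `k`.
    ≤⟨ *-monoʳ-≤ (suc (m + i) * m ^ i * Q * m) (begin
         m * (m * (m + i + 1) + i)
           ≡⟨ *-distribˡ-+ m (m * (m + i + 1)) i ⟩
         m * (m * (m + i + 1)) + m * i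
           ≤⟨ +-monoʳ-≤ (m * (m * (m + i + 1))) (*-mono-≤ (≤-trans (m≤m+n m i) (m≤m+n (m + i) 1)) (<⇒≤ i<k)) ⟩
         m * (m * (m + i + 1)) + (m + i + 1) * k
           ≡⟨ solve 3 (λ m i k → m :* (m :* (m :+ i :+ con 1)) :+ (m :+ i :+ con 1) :* k :=
                (m :+ (con 1 :+ i)) :* (m :* m :+ k)) refl m i k ⟩
         (m + suc i) * (m * m + k) ∎) ⟩
  suc (m + i) * m ^ i * Q * m * ((m + suc i) * (m * m + k))
    ≡⟨ solve 6 (λ s p q m t u → s :* p :* q :* m :* (t :* u) := s :* (m :* p :* t :* (u :* q)))
         refl (suc (m + i)) (m ^ i) Q m (m + suc i) (m * m + k) ⟩
  suc (m + i) * (m * m ^ i * (m + suc i) * ((m * m + k) * Q)) ∎)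
  where
  open ≤-Reasoning
  open +-*-Solver
  p = (1 + m) ^ i
  q = (m * m) ^ i
  Q = (m * m + k) ^ i

^-distrib-* : ∀ m n o → (m * n) ^ o ≡ m ^ o * n ^ o
^-distrib-* m n zero    = refl
^-distrib-* m n (suc o) = trans (cong (m * n *_) (^-distrib-* m n o))
  (solve 4 (λ m n x y → m :* n :* (x :* y) := m :* x :* (n :* y)) refl m n (m ^ o) (n ^ o))
  where open +-*-Solver

-- The quotient of the two powers is the inverse probability that `D` vertices choosing each colour
-- independently with odds 1 : `m` all pick at most one colour. By `[1+m]^i-≤` at `i = k` each
-- vertex contributes at most (1 + k/m²)^k, and `[c+d]^j≤2c^j` bounds the resulting power with
-- exponent `k * D`.
normalisation : ∀ m k D → .{{NonZero m}} → 2 * (k * D * k) ≤ m * m →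
  ((1 + m) ^ k * m) ^ D ≤ 2 * (m ^ k * (m + k)) ^ D
normalisation m k D small = *-cancelʳ-≤ _ _ (((m * m) ^ k) ^ D) (begin
  X ^ D * ((m * m) ^ k) ^ D          ≡⟨ ^-distrib-* X ((m * m) ^ k) D ⟨
  (X * (m * m) ^ k) ^ D              ≤⟨ ^-monoˡ-≤ D ([1+m]^i-≤ m k k ≤-refl) ⟩
  (Z * (m * m + k) ^ k) ^ D          ≡⟨ ^-distrib-* Z ((m * m + k) ^ k) D ⟩
  Z ^ D * ((m * m + k) ^ k) ^ D      ≡⟨ cong (Z ^ D *_) (^-*-assoc (m * m + k) k D) ⟩
  Z ^ D * (m * m + k) ^ (k * D)      ≤⟨ *-monoʳ-≤ (Z ^ D) ([c+d]^j≤2c^j (m * m) k (k * D) {{m*n≢0 m m}} small) ⟩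
  Z ^ D * (2 * (m * m) ^ (k * D))    ≡⟨ cong (λ z → Z ^ D * (2 * z)) (^-*-assoc (m * m) k D) ⟨
  Z ^ D * (2 * ((m * m) ^ k) ^ D)    ≡⟨ solve 2 (λ x y → x :* (con 2 :* y) := con 2 :* x :* y) refl (Z ^ D) _ ⟩
  2 * Z ^ D * ((m * m) ^ k) ^ D      ∎)
  where
  open ≤-Reasoning
  open +-*-Solver
  X = (1 + m) ^ k * m
  Z = m ^ k * (m + k)
  instance
    _ : NonZero (((m * m) ^ k) ^ D)
    _ = m^n≢0 ((m * m) ^ k) D {{m^n≢0 (m * m) k {{m*n≢0 m m}}}}

-- A fixed colour occurs exactly once with probability Dm^(D-1)/(1 + m)^D. Since `2 * D ≤ m` gives
-- (1 + m)^D ≤ 2m^D, this is at least D/(2m), hence at least 1/(r + 1).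
avoid-contracts : ∀ m D r → .{{NonZero m}} → 2 * D ≤ m → 2 * m ≤ suc r * D →
  suc r * avoid m D 0 ≤ r * (1 + m) ^ D
avoid-contracts m D r 2D≤m 2m≤rD = *-cancelˡ-≤ m (+-cancelʳ-≤ (m * X) _ _ (begin
  m * (suc r * A) + m * X
    ≤⟨ +-monoʳ-≤ (m * (suc r * A)) (begin
         m * X                ≤⟨ *-monoʳ-≤ m X≤ ⟩
         m * (2 * m ^ D)      ≡⟨ solve 2 (λ m p → m :* (con 2 :* p) := con 2 :* m :* p) refl m (m ^ D) ⟩
         2 * m * m ^ D        ≤⟨ *-monoˡ-≤ (m ^ D) 2m≤rD ⟩
         suc r * D * m ^ D    ∎) ⟩
  m * (suc r * A) + suc r * D * m ^ D
    ≡⟨ solve 5 (λ m s a d p → m :* (s :* a) :+ s :* d :* p := s :* (m :* a :+ d :* p)) refl m (suc r) A D (m ^ D) ⟩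
  suc r * (m * A + D * m ^ D)
    ≡⟨ cong (suc r *_) (avoid-0 m D) ⟩
  suc r * (m * X)
    ≡⟨ solve 3 (λ r m x → (con 1 :+ r) :* (m :* x) := m :* (r :* x) :+ m :* x) refl r m X ⟩
  m * (r * X) + m * X ∎))
  where
  open ≤-Reasoning
  open +-*-Solver
  A = avoid m D 0
  X = (1 + m) ^ D
  X≤ : X ≤ 2 * m ^ D
  X≤ = ≤-trans (≤-reflexive (cong (_^ D) (+-comm 1 m)))
         ([c+d]^j≤2c^j m 1 D (≤-trans (≤-reflexive (cong (2 *_) (*-identityʳ D))) 2D≤m))

module _ (m k r : ℕ) .{{_ : NonZero m}} where
  open WeightedSum (weight m {k})

  -- Passing to independent colours costs the factor 2 of `normalisation`; each of the `k` colours
  -- then contributes a factor r/(r + 1) by `avoid-contracts`.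
  E-noUnique-small : ∀ {n} {T : Pred (Fin n) 0ℓ} (T? : Decidable T) → let D = count T? in
    2 * (k * D * k) ≤ m * m → 2 * D ≤ m → 2 * m ≤ suc r * D →
    E (noUnique T? (λ _ → 0)) * suc r ^ k ≤ 2 * r ^ k * (m + k) ^ n
  E-noUnique-small {n} T? small 2D≤m 2m≤rD = *-cancelʳ-≤ _ _ Y (begin
    e * suc r ^ k * Y
      ≡⟨ solve 3 (λ e s y → e :* s :* y := s :* (e :* y)) refl e (suc r ^ k) Y ⟩
    suc r ^ k * (e * Y)
      ≤⟨ *-monoʳ-≤ (suc r ^ k) (E-noUnique m k T? (λ _ → 0)) ⟩
    suc r ^ k * (m ^ D * (m + k) ^ n * ∏ {k} (λ _ → A))
      ≡⟨ cong (λ z → suc r ^ k * (m ^ D * (m + k) ^ n * z)) (∏-const k A) ⟩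
    suc r ^ k * (m ^ D * (m + k) ^ n * A ^ k)
      ≡⟨ solve 4 (λ s p w a → s :* (p :* w :* a) := p :* w :* (s :* a)) refl (suc r ^ k) (m ^ D) ((m + k) ^ n) (A ^ k) ⟩
    m ^ D * (m + k) ^ n * (suc r ^ k * A ^ k)
      ≡⟨ cong (m ^ D * (m + k) ^ n *_) (^-distrib-* (suc r) A k) ⟨
    m ^ D * (m + k) ^ n * (suc r * A) ^ k
      ≤⟨ *-monoʳ-≤ (m ^ D * (m + k) ^ n) (^-monoˡ-≤ k (avoid-contracts m D r 2D≤m 2m≤rD)) ⟩
    m ^ D * (m + k) ^ n * (r * (1 + m) ^ D) ^ k
      ≡⟨ cong (m ^ D * (m + k) ^ n *_) (trans (^-distrib-* r ((1 + m) ^ D) k) (cong (r ^ k *_) swap)) ⟩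
    m ^ D * (m + k) ^ n * (r ^ k * ((1 + m) ^ k) ^ D)
      ≡⟨ solve 4 (λ p w s a → p :* w :* (s :* a) := s :* w :* (a :* p)) refl (m ^ D) ((m + k) ^ n) (r ^ k) (((1 + m) ^ k) ^ D) ⟩
    r ^ k * (m + k) ^ n * (((1 + m) ^ k) ^ D * m ^ D)
      ≡⟨ cong (r ^ k * (m + k) ^ n *_) (^-distrib-* ((1 + m) ^ k) m D) ⟨
    r ^ k * (m + k) ^ n * ((1 + m) ^ k * m) ^ D
      ≤⟨ *-monoʳ-≤ (r ^ k * (m + k) ^ n) (normalisation m k D small) ⟩
    r ^ k * (m + k) ^ n * (2 * Y)
      ≡⟨ solve 3 (λ s w y → s :* w :* (con 2 :* y) := con 2 :* s :* w :* y) refl (r ^ k) ((m + k) ^ n) Y ⟩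
    2 * r ^ k * (m + k) ^ n * Y ∎)
    where
    open ≤-Reasoning
    open +-*-Solver
    D = count T?
    A = avoid m D 0
    Y = (m ^ k * (m + k)) ^ D
    e = E (noUnique T? (λ _ → 0))
    swap : ((1 + m) ^ D) ^ k ≡ ((1 + m) ^ k) ^ D
    swap = trans (^-*-assoc (1 + m) D k) (trans (cong ((1 + m) ^_) (*-comm D k)) (sym (^-*-assoc (1 + m) k D)))
    instance
      _ : NonZero Y
      _ = m^n≢0 (m ^ k * (m + k)) D {{m*n≢0 (m ^ k) (m + k) {{m^n≢0 m k}} {{>-nonZero (≤-trans (>-nonZero⁻¹ m) (m≤m+n m k))}}}}

-- For positive `x` this is Bernoulli's inequality (1 + 1/x)^n ≥ 1 + n/x, cleared of denominators.
x^n*[x+n]≤x*[1+x]^n : ∀ x n → x ^ n * (x + n) ≤ x * suc x ^ n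
x^n*[x+n]≤x*[1+x]^n x zero    = ≤-reflexive (solve 1 (λ x → con 1 :* (x :+ con 0) := x :* con 1) refl x)
  where open +-*-Solver
x^n*[x+n]≤x*[1+x]^n x (suc n) = begin
  x * x ^ n * (x + suc n)                 ≤⟨ m≤m+n _ (x ^ n * n) ⟩
  x * x ^ n * (x + suc n) + x ^ n * n     ≡⟨ solve 3 (λ x p n → x :* p :* (x :+ (con 1 :+ n)) :+ p :* n := (con 1 :+ x) :* (p :* (x :+ n))) refl x (x ^ n) n ⟩
  suc x * (x ^ n * (x + n))               ≤⟨ *-monoʳ-≤ (suc x) (x^n*[x+n]≤x*[1+x]^n x n) ⟩
  suc x * (x * suc x ^ n)                 ≡⟨ solve 3 (λ s x p → s :* (x :* p) := x :* (s :* p)) refl (suc x) x (suc x ^ n) ⟩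
  x * (suc x * suc x ^ n)                 ∎
  where
  open ≤-Reasoning
  open +-*-Solver

-- For positive `r`, (1 + 1/r)^(r+1) ≥ 1 + (r + 1)/r > 2. So each block of `suc r` colours halves
-- the failure bound.
2*r^[1+r]≤[1+r]^[1+r] : ∀ r → 2 * r ^ suc r ≤ suc r ^ suc r
2*r^[1+r]≤[1+r]^[1+r] zero        = z≤n
2*r^[1+r]≤[1+r]^[1+r] r@(suc _) = *-cancelˡ-≤ r (begin
  r * (2 * r ^ suc r)         ≡⟨ solve 2 (λ r p → r :* (con 2 :* p) := p :* (r :+ r)) refl r (r ^ suc r) ⟩
  r ^ suc r * (r + r)         ≤⟨ *-monoʳ-≤ (r ^ suc r) (+-monoʳ-≤ r (n≤1+n r)) ⟩
  r ^ suc r * (r + suc r)     ≤⟨ x^n*[x+n]≤x*[1+x]^n r (suc r) ⟩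
  r * suc r ^ suc r           ∎)
  where
  open ≤-Reasoning
  open +-*-Solver

-- Groups the `k` factors r/(r + 1) into `t` blocks, each worth at most 1/2.
2^t*r^k≤[1+r]^k : ∀ r t → let k = suc r * t in 2 ^ t * r ^ k ≤ suc r ^ k
2^t*r^k≤[1+r]^k r t = begin
  2 ^ t * r ^ (suc r * t)       ≡⟨ cong (2 ^ t *_) (^-*-assoc r (suc r) t) ⟨
  2 ^ t * (r ^ suc r) ^ t       ≡⟨ ^-distrib-* 2 (r ^ suc r) t ⟨
  (2 * r ^ suc r) ^ t           ≤⟨ ^-monoˡ-≤ t (2*r^[1+r]≤[1+r]^[1+r] r) ⟩
  (suc r ^ suc r) ^ t           ≡⟨ ^-*-assoc (suc r) (suc r) t ⟩
  suc r ^ (suc r * t)           ∎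
  where open ≤-Reasoning

-- Conflict-free colourings

module _ (G : Graph) where
  open Graph G

  _∈N?_ : (w v : Vertex) → Dec (w ∈N[ v ])
  w ∈N? v = (w Fin.≟ v) ⊎-dec (v ~? w)

  ∈N-sym : ∀ {v w} → w ∈N[ v ] → v ∈N[ w ]
  ∈N-sym (inj₁ w≡v) = inj₁ (sym w≡v)
  ∈N-sym (inj₂ v~w) = inj₂ (~-sym v~w)

  count-closedNeighbourhood : ∀ v → count (_∈N? v) ≡ suc (degree v)
  count-closedNeighbourhood v = begin
    count (_∈N? v)                             ≡⟨ sum-cong-≗ disjoint ⟩
    sum (λ w → 𝟙 (w Fin.≟ v) + 𝟙 (v ~? w))     ≡⟨ ∑-distrib-+ (λ w → 𝟙 (w Fin.≟ v)) (λ w → 𝟙 (v ~? w)) ⟩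
    count (Fin._≟ v) + count (v ~?_)           ≡⟨ cong₂ _+_ (count-≡ v) (sym (length-filter-tabulate (v ~?_) id)) ⟩
    suc (degree v)                             ∎
    where
    open ≡-Reasoning
    disjoint : ∀ w → 𝟙 (w ∈N? v) ≡ 𝟙 (w Fin.≟ v) + 𝟙 (v ~? w)
    disjoint w with w Fin.≟ v | v ~? w
    ... | yes refl | yes v~v = contradiction v~v (~-irr refl)
    ... | yes _    | no  _   = refl
    ... | no  _    | yes _   = refl
    ... | no  _    | no  _   = refl

  module _ (d : ℕ) (N≤d : ∀ v → suc (degree v) ≤ d) where

    -- Two events are near when their closed neighbourhoods share a vertex `w`. There are at most
    -- `d` choices of `w` around `v`, and then, by symmetry of the relation, at most `d` choices of
    -- `u` around `w`.
    count-near : ∀ v → count (λ u → Fin.any? λ w → (w ∈N? v) ×-dec (w ∈N? u)) ≤ d * d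
    count-near v = begin
      count (λ u → Fin.any? λ w → (w ∈N? v) ×-dec (w ∈N? u))
        ≤⟨ sum-mono (λ u → any-≤ (_∈N? v) (_∈N? u)) ⟩
      sum (λ u → sum λ w → 𝟙 (w ∈N? v) * 𝟙 (w ∈N? u))
        ≡⟨ ∑-comm (λ u w → 𝟙 (w ∈N? v) * 𝟙 (w ∈N? u)) ⟩
      sum (λ w → sum λ u → 𝟙 (w ∈N? v) * 𝟙 (w ∈N? u))
        ≤⟨ sum-mono (λ w → ≤-trans (≤-reflexive (sym (*-distribˡ-sum (𝟙 (w ∈N? v)) (λ u → 𝟙 (w ∈N? u)))))
             (*-monoʳ-≤ (𝟙 (w ∈N? v)) (col w))) ⟩
      sum (λ w → 𝟙 (w ∈N? v) * d)
        ≡⟨ *-distribʳ-sum d (λ w → 𝟙 (w ∈N? v)) ⟨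
      count (_∈N? v) * d
        ≤⟨ *-monoˡ-≤ d (≤-trans (≤-reflexive (count-closedNeighbourhood v)) (N≤d v)) ⟩
      d * d ∎
      where
      open ≤-Reasoning
      any-≤ : ∀ {n} {P Q : Pred (Fin n) 0ℓ} (P? : Decidable P) (Q? : Decidable Q) →
        𝟙 (Fin.any? λ w → P? w ×-dec Q? w) ≤ sum λ w → 𝟙 (P? w) * 𝟙 (Q? w)
      any-≤ {zero}  P? Q? = z≤n
      any-≤ {suc n} P? Q? with does (P? zero) | does (Q? zero)
      ... | true  | true  = s≤s z≤n
      ... | true  | false = any-≤ (P? ∘ suc) (Q? ∘ suc)
      ... | false | _     = any-≤ (P? ∘ suc) (Q? ∘ suc)
      col : ∀ w → sum (λ u → 𝟙 (w ∈N? u)) ≤ d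
      col w = ≤-trans (≤-reflexive (trans (sum-cong-≗ λ u → 𝟙-cong (w ∈N? u) (u ∈N? w) ∈N-sym ∈N-sym)
                (count-closedNeighbourhood w))) (N≤d w)

  -- The hypothesis with `4 * d` is the last premise of `avoid-contracts` for blank weight `2 * d`,
  -- and `k * k ≤ d` yields the premise of `normalisation`. The last one brings the failure
  -- probability, at most 2(r/(r + 1))^k, down to 1/(4d²). The extra colour is the blank.
  cfColourable-log : ∀ d r t → let k = suc r * t in .{{NonZero d}} →
    (∀ v → suc (degree v) ≤ d) → (∀ v → 4 * d ≤ suc r * suc (degree v)) →
    k * k ≤ d → 8 * (d * d) ≤ 2 ^ t → CFColourable (suc k)
  cfColourable-log d r t N≤d N≥ k²≤d 8d²≤2^t = lookup xs , conflictFree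
    where
    open +-*-Solver
    k m q : ℕ
    k = suc r * t
    m = 2 * d
    -- Half of `q` is the bound of `count-near`, and 1/(2q) is the failure probability 1/(4d²).
    q = 2 * (d * d)
    instance
      m≢0 : NonZero m
      m≢0 = m*n≢0 2 d
      r^k≢0 : NonZero (suc r ^ k)
      r^k≢0 = m^n≢0 (suc r) k
    bad : Vertex → Vec (Fin (suc k)) order → ℕ
    bad v = noUnique (_∈N? v) (λ _ → 0)
    open WeightedSum (weight m {k})
    open LocalLemma (weight m {k}) bad (λ v → noUnique≤1 (_∈N? v) (λ _ → 0))
      (λ v → _∈N? v) (λ v → noUnique-dep (_∈N? v) (λ _ → 0))

    bad-small : ∀ v → 2 * q * E (bad v) ≤ W ^ order
    bad-small v = *-cancelʳ-≤ _ _ (suc r ^ k) (begin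
      2 * q * E (bad v) * suc r ^ k
        ≡⟨ *-assoc (2 * q) (E (bad v)) (suc r ^ k) ⟩
      2 * q * (E (bad v) * suc r ^ k)
        ≤⟨ *-monoʳ-≤ (2 * q) (E-noUnique-small m k r (_∈N? v)
             (subst (λ D → 2 * (k * D * k) ≤ m * m) (sym size) small)
             (subst (λ D → 2 * D ≤ m) (sym size) (*-monoʳ-≤ 2 (N≤d v)))
             (subst (λ D → 2 * m ≤ suc r * D) (sym size) (≤-trans (≤-reflexive (sym (*-assoc 2 2 d))) (N≥ v)))) ⟩
      2 * q * (2 * r ^ k * (m + k) ^ order)
        ≡⟨ solve 3 (λ x p w → con 2 :* (con 2 :* x) :* (con 2 :* p :* w) := w :* (con 8 :* x :* p)) refl (d * d) (r ^ k) ((m + k) ^ order) ⟩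
      (m + k) ^ order * (8 * (d * d) * r ^ k)
        ≤⟨ *-monoʳ-≤ ((m + k) ^ order) (≤-trans (*-monoˡ-≤ (r ^ k) 8d²≤2^t) (2^t*r^k≤[1+r]^k r t)) ⟩
      (m + k) ^ order * suc r ^ k
        ≡⟨ cong (λ z → z ^ order * suc r ^ k) (total-weight m k) ⟨
      W ^ order * suc r ^ k ∎)
      where
      open ≤-Reasoning
      size = count-closedNeighbourhood v
      small : 2 * (k * suc (degree v) * k) ≤ m * m
      small = begin
        2 * (k * suc (degree v) * k)   ≡⟨ solve 2 (λ k D → con 2 :* (k :* D :* k) := con 2 :* (k :* k :* D)) refl k (suc (degree v)) ⟩
        2 * (k * k * suc (degree v))   ≤⟨ *-monoʳ-≤ 2 (*-mono-≤ k²≤d (N≤d v)) ⟩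
        2 * (d * d)                    ≤⟨ m≤m+n (2 * (d * d)) (2 * (d * d)) ⟩
        2 * (d * d) + 2 * (d * d)      ≡⟨ solve 1 (λ d → con 2 :* (d :* d) :+ con 2 :* (d :* d) := con 2 :* d :* (con 2 :* d)) refl d ⟩
        2 * d * (2 * d)                ∎

    avoiding : ∃ λ xs → ∀ v → bad v xs ≡ 0
    avoiding = local-lemma {q} (*-monoʳ-≤ 2 (>-nonZero⁻¹ (d * d) {{m*n≢0 d d}}))
      (subst (0 <_) (sym (total-weight m k)) (≤-trans (>-nonZero⁻¹ m) (m≤m+n m k))) bad-small
      λ v → *-monoʳ-≤ 2 (≤-trans (≤-reflexive (length-filter-tabulate (near? v) id)) (count-near d N≤d v))

    xs : Vec (Fin (suc k)) order
    xs = proj₁ avoiding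

    conflictFree : ConflictFree (lookup xs)
    conflictFree v = let i , unique = noUnique≡0⇒∃! (_∈N? v) xs (proj₂ avoiding v) in suc i , unique

-- Binary logarithms and the choice of parameters

⌊log₂⌋-exists : ∀ n → 0 < n → ∃ λ ℓ → 2 ^ ℓ ≤ n × n < 2 ^ suc ℓ
⌊log₂⌋-exists (suc zero)      _ = 0 , ≤-refl , ≤-refl
⌊log₂⌋-exists (suc n@(suc _)) _ with ⌊log₂⌋-exists n (s≤s z≤n)
... | ℓ , lower , upper with 2 ^ suc ℓ ≤? suc n
...   | yes p = suc ℓ , p , ≤-trans (s≤s upper) (begin
    suc (2 ^ suc ℓ)        ≤⟨ +-monoˡ-≤ (2 ^ suc ℓ) (m^n>0 2 (suc ℓ)) ⟩
    2 ^ suc ℓ + 2 ^ suc ℓ  ≡⟨ cong (_+_ (2 ^ suc ℓ)) (+-identityʳ _) ⟨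
    2 ^ suc (suc ℓ)        ∎)
    where open ≤-Reasoning
...   | no ¬p = ℓ , m≤n⇒m≤1+n lower , ≰⇒> ¬p

n³≤2^n : ∀ n → 10 ≤ n → n * n * n ≤ 2 ^ n
n³≤2^n n 10≤n = subst (λ n → n * n * n ≤ 2 ^ n) (m+[n∸m]≡n 10≤n) (go (n ∸ 10))
  where
  open ≤-Reasoning
  open +-*-Solver
  go : ∀ i → (10 + i) * (10 + i) * (10 + i) ≤ 2 ^ (10 + i)
  go zero    = m≤m+n 1000 24
  go (suc i) = begin
    (10 + suc i) * (10 + suc i) * (10 + suc i)
      -- The added polynomial is 2n³ - (n + 1)³ at n = 10 + i; its coefficients in `i` are all
      -- positive.
      ≤⟨ m≤m+n _ (669 + 237 * i + 27 * (i * i) + i * i * i) ⟩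
    (10 + suc i) * (10 + suc i) * (10 + suc i) + (669 + 237 * i + 27 * (i * i) + i * i * i)
      ≡⟨ solve 1 (λ i → (con 11 :+ i) :* (con 11 :+ i) :* (con 11 :+ i) :+
           (con 669 :+ con 237 :* i :+ con 27 :* (i :* i) :+ i :* i :* i) :=
           con 2 :* ((con 10 :+ i) :* (con 10 :+ i) :* (con 10 :+ i))) refl i ⟩
    2 * ((10 + i) * (10 + i) * (10 + i))
      ≤⟨ *-monoʳ-≤ 2 (go i) ⟩
    2 ^ (10 + suc i) ∎

module _ (G : Graph) where
  open Graph G using (Vertex; degree; CFColourable)

  degree≤maxDegree : ∀ v → degree v ≤ maxDegree G
  degree≤maxDegree v = All.lookup (xs≤max 0 (map degree (allFin _))) (∈-map⁺ degree (∈-allFin v))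

  minDegree≤degree : ∀ v → minDegree G ≤ degree v
  minDegree≤degree v = All.lookup (min≤xs _ (map degree (allFin _))) (∈-map⁺ degree (∈-allFin v))

  χCF-minimal : ∀ {j} → CFColourable j → χCF G ≤ j
  χCF-minimal {j} = proj₂ (proj₂ (χCF-exists G)) j

  -- The number k = Rt of proper colours is at most 7Rℓ, so k² ≤ 49R²ℓ² ≤ ℓ³ ≤ 2^ℓ ≤ Δ; this is
  -- where 49 comes from. One further Rℓ pays for the blank colour.
  χCF≤log : ∀ a ℓ → let Δ = maxDegree G ; R = 4 + 4 * a in
    Δ ≤ a * suc (minDegree G) → 2 ^ ℓ ≤ Δ → Δ < 2 ^ suc ℓ → 49 * (R * R) ≤ ℓ →
    χCF G ≤ 8 * (R * ℓ)
  χCF≤log a ℓ Δ≤aδ lower upper large = ≤-trans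
    (χCF-minimal (cfColourable-log G (suc Δ) (3 + 4 * a) t
      (λ v → s≤s (degree≤maxDegree v)) degree-large k²≤d
      (≤-trans (*-monoʳ-≤ 8 (*-mono-≤ upper upper)) (≤-reflexive 2^t))))
    (begin
      suc (R * t)           ≤⟨ s≤s (*-monoʳ-≤ R t≤7ℓ) ⟩
      1 + R * (7 * ℓ)       ≤⟨ +-monoˡ-≤ (R * (7 * ℓ)) (*-mono-≤ {1} {R} (s≤s z≤n) 1≤ℓ) ⟩
      R * ℓ + R * (7 * ℓ)   ≡⟨ solve 2 (λ R l → R :* l :+ R :* (con 7 :* l) := con 8 :* (R :* l)) refl R ℓ ⟩
      8 * (R * ℓ)           ∎)
    where
    open ≤-Reasoning
    open +-*-Solver
    Δ R t : ℕ
    Δ = maxDegree G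
    -- This is `suc r` for r = 3 + 4a: with D = deg v + 1, the bounds 1 ≤ D and Δ ≤ aD give 4(Δ + 1)
    -- ≤ (4 + 4a)D.
    R = 4 + 4 * a
    -- Chosen so that 2^t = 8(2^(ℓ+1))², which is at least 8(Δ + 1)².
    t = 3 + (suc ℓ + suc ℓ)

    49≤ℓ : 49 ≤ ℓ
    49≤ℓ = ≤-trans (*-monoʳ-≤ 49 (*-mono-≤ {1} {R} {1} {R} (s≤s z≤n) (s≤s z≤n))) large
    1≤ℓ : 1 ≤ ℓ
    1≤ℓ = ≤-trans (s≤s z≤n) 49≤ℓ

    t≤7ℓ : t ≤ 7 * ℓ
    t≤7ℓ = begin
      t                     ≡⟨ solve 1 (λ l → con 3 :+ ((con 1 :+ l) :+ (con 1 :+ l)) := con 5 :+ con 2 :* l) refl ℓ ⟩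
      5 * 1 + 2 * ℓ         ≤⟨ +-monoˡ-≤ (2 * ℓ) (*-monoʳ-≤ 5 1≤ℓ) ⟩
      5 * ℓ + 2 * ℓ         ≡⟨ *-distribʳ-+ ℓ 5 2 ⟨
      7 * ℓ                 ∎

    2^t : 8 * (2 ^ suc ℓ * 2 ^ suc ℓ) ≡ 2 ^ t
    2^t = trans (cong (8 *_) (sym (^-distribˡ-+-* 2 (suc ℓ) (suc ℓ)))) (sym (^-distribˡ-+-* 2 3 (suc ℓ + suc ℓ)))

    k²≤d : R * t * (R * t) ≤ suc Δ
    k²≤d = begin
      R * t * (R * t)               ≤⟨ *-mono-≤ (*-monoʳ-≤ R t≤7ℓ) (*-monoʳ-≤ R t≤7ℓ) ⟩
      R * (7 * ℓ) * (R * (7 * ℓ))   ≡⟨ solve 2 (λ R l → R :* (con 7 :* l) :* (R :* (con 7 :* l)) := con 49 :* (R :* R) :* (l :* l)) refl R ℓ ⟩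
      49 * (R * R) * (ℓ * ℓ)        ≤⟨ *-monoˡ-≤ (ℓ * ℓ) large ⟩
      ℓ * (ℓ * ℓ)                   ≡⟨ *-assoc ℓ ℓ ℓ ⟨
      ℓ * ℓ * ℓ                     ≤⟨ n³≤2^n ℓ (≤-trans (m≤m+n 10 39) 49≤ℓ) ⟩
      2 ^ ℓ                         ≤⟨ lower ⟩
      Δ                             ≤⟨ n≤1+n Δ ⟩
      suc Δ                         ∎

    degree-large : ∀ v → 4 * suc Δ ≤ R * suc (degree v)
    degree-large v = begin
      4 * suc Δ                         ≡⟨ *-suc 4 Δ ⟩
      4 * 1 + 4 * Δ                     ≤⟨ +-mono-≤ (*-monoʳ-≤ 4 {1} {D} (s≤s z≤n))
                                             (*-monoʳ-≤ 4 (≤-trans Δ≤aδ (*-monoʳ-≤ a (s≤s (minDegree≤degree v))))) ⟩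
      4 * D + 4 * (a * D)               ≡⟨ solve 2 (λ a D → con 4 :* D :+ con 4 :* (a :* D) := (con 4 :+ con 4 :* a) :* D) refl a D ⟩
      R * D                             ∎
      where D = suc (degree v)

-- Rational and real bounds

/-cancel-≤ : ∀ a b c d → + a / suc b ℚ.≤ + c / suc d → a * suc d ≤ c * suc b
/-cancel-≤ a b c d h = ℤ.drop‿+≤+ (subst₂ ℤ._≤_ (sym (ℤ.pos-* a (suc d))) (sym (ℤ.pos-* c (suc b)))
  (ℚᵘ.drop-*≤* (begin
    ℚᵘ.mkℚᵘ (+ a) b       ≃⟨ ℚ.toℚᵘ-fromℚᵘ (ℚᵘ.mkℚᵘ (+ a) b) ⟨
    toℚᵘ (+ a / suc b)    ≤⟨ ℚ.toℚᵘ-mono-≤ h ⟩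
    toℚᵘ (+ c / suc d)    ≃⟨ ℚ.toℚᵘ-fromℚᵘ (ℚᵘ.mkℚᵘ (+ c) d) ⟩
    ℚᵘ.mkℚᵘ (+ c) d       ∎)))
  where open ℚᵘ.≤-Reasoning

/-* : ∀ a b c d → (+ a / suc b) ℚ.* (+ c / suc d) ≡ + (a * c) / suc (d + b * suc d)
/-* a b c d = ℚ.toℚᵘ-injective (begin
  toℚᵘ ((+ a / suc b) ℚ.* (+ c / suc d))              ≈⟨ ℚ.toℚᵘ-homo-* (+ a / suc b) (+ c / suc d) ⟩
  toℚᵘ (+ a / suc b) ℚᵘ.* toℚᵘ (+ c / suc d)      ≈⟨ ℚᵘ.*-cong (ℚ.toℚᵘ-fromℚᵘ (ℚᵘ.mkℚᵘ (+ a) b)) (ℚ.toℚᵘ-fromℚᵘ (ℚᵘ.mkℚᵘ (+ c) d)) ⟩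
  ℚᵘ.mkℚᵘ (+ a ℤ.* + c) (d + b * suc d)           ≡⟨ cong (λ z → ℚᵘ.mkℚᵘ z (d + b * suc d)) (ℤ.pos-* a c) ⟨
  ℚᵘ.mkℚᵘ (+ (a * c)) (d + b * suc d)             ≈⟨ ℚ.toℚᵘ-fromℚᵘ (ℚᵘ.mkℚᵘ (+ (a * c)) (d + b * suc d)) ⟨
  toℚᵘ (+ (a * c) / suc (d + b * suc d))          ∎)
  where open import Relation.Binary.Reasoning.Setoid ℚᵘ.≃-setoid

0≤/ : ∀ a b → 0ℚ ℚ.≤ + a / suc b
0≤/ a b = /-mono 0 0 a b z≤n

harmonic-mono : ∀ a {k l} → k ≤ l → harmonic a k ℚ.≤ harmonic a l
harmonic-mono a {k} {l} k≤l = begin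
  harmonic a k                                       ≡⟨ ℚ.+-identityʳ (harmonic a k) ⟨
  harmonic a k ℚ.+ 0ℚ                                ≤⟨ ℚ.+-monoʳ-≤ (harmonic a k) (ℚ.≤-trans (0≤/ (l ∸ k) (a + k + (l ∸ k)))
                                                          (harmonic-lower (a + k) (l ∸ k) _ (n≤1+n _))) ⟩
  harmonic a k ℚ.+ harmonic (a + k) (l ∸ k)          ≡⟨ harmonic-split a k (l ∸ k) ⟨
  harmonic a (k + (l ∸ k))                           ≡⟨ cong (harmonic a) (m+[n∸m]≡n k≤l) ⟩
  harmonic a l                                       ∎
  where open ℚ.≤-Reasoning

-- Oresme's grouping: going from 2^ℓ to 2^(ℓ+1) adds 2^ℓ reciprocals, each at least 1/2^(ℓ+1), hence
-- at least 1/2 in total. The sum begins with 1/2 and not with 1, so it has 2^ℓ - 1 terms.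
harmonic-dyadic : ∀ ℓ e → suc e ≡ 2 ^ ℓ → + ℓ / 2 ℚ.≤ harmonic 1 e
harmonic-dyadic zero    e eq = ℚ.≤-trans (ℚ.≤-reflexive (0/ 1)) (harmonic-mono 1 {0} {e} z≤n)
harmonic-dyadic (suc ℓ) e eq with 2 ^ ℓ in 2^ℓ≡
... | zero   = contradiction eq λ ()
... | suc e′ = begin
  + suc ℓ / 2                                                 ≡⟨ /-suc ℓ 1 ⟩
  + ℓ / 2 ℚ.+ + 1 / 2                                         ≤⟨ ℚ.+-mono-≤ (harmonic-dyadic ℓ e′ (sym 2^ℓ≡)) half ⟩
  harmonic 1 e′ ℚ.+ harmonic (suc e′) (suc e′)                ≡⟨ harmonic-split 1 e′ (suc e′) ⟨
  harmonic 1 (e′ + suc e′)                                    ≡⟨ cong (harmonic 1) (suc-injective (trans (cong (_+_ (suc e′)) (sym (+-identityʳ (suc e′)))) (sym eq))) ⟩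
  harmonic 1 e                                                ∎
  where
  open ℚ.≤-Reasoning
  open +-*-Solver
  half : + 1 / 2 ℚ.≤ harmonic (suc e′) (suc e′)
  half = ℚ.≤-trans
    (/-mono 1 1 (suc e′) (e′ + suc e′) (≤-reflexive (solve 1 (λ x →
      con 1 :* (con 1 :+ (x :+ (con 1 :+ x))) := (con 1 :+ x) :* con 2) refl e′)))
    (harmonic-lower (suc e′) (suc e′) (e′ + suc e′) ≤-refl)

-- The Riemann sums increase as the mesh is refined, so the one with mesh 1, which is 1/2 + ... +
-- 1/m, already bounds them all from below.
lnSeq-lower : ∀ ℓ m n → 2 ^ ℓ ≤ m → + ℓ / 2 ℚ.≤ lnSeq m n
lnSeq-lower ℓ m n 2^ℓ≤m with 2 ^ ℓ in 2^ℓ≡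
... | zero  = contradiction (subst (0 <_) 2^ℓ≡ (m^n>0 2 ℓ)) λ ()
lnSeq-lower ℓ (suc p) n (s≤s e≤p) | suc e = begin
  + ℓ / 2             ≤⟨ harmonic-dyadic ℓ e (sym 2^ℓ≡) ⟩
  harmonic 1 e        ≤⟨ harmonic-mono 1 e≤p ⟩
  harmonic 1 p        ≡⟨ cong (harmonic 1) (*-identityʳ p) ⟨
  lnSeq (suc p) 0     ≤⟨ lnSeq-mono p (≤⇒≤′ z≤n) ⟩
  lnSeq (suc p) n     ∎
  where open ℚ.≤-Reasoning

-- `a` is chosen with 1/a at most the gap between 0 and α, before `x` and `y` are given, so it
-- serves all graphs at once. The comparison of reals is read at one common index with tolerance 1,
-- which accounts for `suc y`.
*ℝ-≤ℝ⇒≤ : ∀ {α} → 0ℝ <ℝ α → ∃ λ a → ∀ x y → α *ℝ fromℕ x ≤ℝ fromℕ y → x ≤ a * suc y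
*ℝ-≤ℝ⇒≤ {α} (ε , 0<ε , N₁ , ε≤α) with archimedean ε 0<ε
... | K , 1/K≤ε = suc K , bound
  where
  open ℚ.≤-Reasoning
  bound : ∀ x y → α *ℝ fromℕ x ≤ℝ fromℕ y → x ≤ suc K * suc y
  bound x y αx≤y with αx≤y 1ℚ (ℚ.positive⁻¹ 1ℚ)
  ... | N₂ , close = ≤-trans (≤-reflexive (sym (*-identityʳ x)))
      (≤-trans (/-cancel-≤ x K (suc y) 0 x/a≤1+y) (≤-reflexive (*-comm (suc y) (suc K))))
    where
    n = N₁ + N₂
    x/a≤1+y : + x / suc K ℚ.≤ + suc y / 1
    x/a≤1+y = begin
      + x / suc K                    ≡⟨ cong₂ (λ u v → + u / suc v) (+-identityʳ x) (*-identityʳ K) ⟨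
      + (1 * x) / suc (K * 1)        ≡⟨ /-* 1 K x 0 ⟨
      (+ 1 / suc K) ℚ.* (+ x / 1)        ≤⟨ ℚ.*-monoʳ-≤-nonNeg (+ x / 1) {{ℚ.nonNegative (0≤/ x 0)}}
                                          (ℚ.≤-trans 1/K≤ε (ℚ.≤-trans (ℚ.≤-reflexive (sym (ℚ.+-identityˡ ε)))
                                            (ε≤α n (m≤m+n N₁ N₂)))) ⟩
      seq α n ℚ.* (+ x / 1)            ≤⟨ close n (m≤n+m N₂ N₁) ⟩
      + y / 1 ℚ.+ 1ℚ                 ≡⟨ /-suc y 0 ⟨
      + suc y / 1                    ∎

-- The lower bound ℓ/2 holds for every term of `lnSeq m`, so the comparison already holds from index
-- 0 and the tolerance is pure slack.
≤ℝ-ln : ∀ c ℓ x m → 2 * x ≤ c * ℓ → 2 ^ ℓ ≤ m → fromℕ x ≤ℝ fromℕ c *ℝ ln m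
≤ℝ-ln c ℓ x m 2x≤cℓ 2^ℓ≤m ε 0<ε = 0 , λ n _ → begin
  + x / 1                            ≤⟨ /-mono x 0 (c * ℓ) 1 (≤-trans (≤-reflexive (*-comm x 2)) (≤-trans 2x≤cℓ (≤-reflexive (sym (*-identityʳ (c * ℓ)))))) ⟩
  + (c * ℓ) / 2                      ≡⟨ /-* c 0 ℓ 1 ⟨
  (+ c / 1) ℚ.* (+ ℓ / 2)                ≤⟨ ℚ.*-monoˡ-≤-nonNeg (+ c / 1) {{ℚ.nonNegative (0≤/ c 0)}} (lnSeq-lower ℓ m n 2^ℓ≤m) ⟩
  (+ c / 1) ℚ.* lnSeq m n              ≡⟨ ℚ.+-identityʳ _ ⟨
  (+ c / 1) ℚ.* lnSeq m n ℚ.+ 0ℚ       ≤⟨ ℚ.+-monoʳ-≤ ((+ c / 1) ℚ.* lnSeq m n) (ℚ.<⇒≤ 0<ε) ⟩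
  (+ c / 1) ℚ.* lnSeq m n ℚ.+ ε        ∎
  where open ℚ.≤-Reasoning

theorem1 : (α : ℝ) → 0ℝ <ℝ α →
    Σ[ C ∈ ℝ ] Σ[ Δ₀ ∈ ℕ ] (0ℝ <ℝ C ×
    ((G : Graph) → Δ₀ ≤ maxDegree G →
    α *ℝ fromℕ (maxDegree G) ≤ℝ fromℕ (minDegree G) →
    fromℕ (χCF G) ≤ℝ C *ℝ ln (maxDegree G)))
-- `χCF≤log` gives 8Rℓ, and ℓ ≤ 2 ln Δ turns this into 16R ln Δ. The threshold `2 ^ L` forces the
-- binary logarithm ℓ of Δ to be at least `L`, as `χCF≤log` requires.
theorem1 α 0<α = fromℕ (16 * R) , 2 ^ L , (1ℚ , ℚ.positive⁻¹ 1ℚ , 0 , λ _ _ → 1≤16R) , bound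
  where
  a R L : ℕ
  a = proj₁ (*ℝ-≤ℝ⇒≤ {α} 0<α)
  R = 4 + 4 * a
  L = 49 * (R * R)
  1≤16R : 0ℚ ℚ.+ 1ℚ ℚ.≤ + (16 * R) / 1
  1≤16R = /-mono 1 0 (16 * R) 0 (*-monoˡ-≤ 1 (*-mono-≤ {1} {16} {1} {R} (s≤s z≤n) (s≤s z≤n)))
  bound : (G : Graph) → 2 ^ L ≤ maxDegree G → α *ℝ fromℕ (maxDegree G) ≤ℝ fromℕ (minDegree G) →
    fromℕ (χCF G) ≤ℝ fromℕ (16 * R) *ℝ ln (maxDegree G)
  bound G Δ₀≤Δ αΔ≤δ =
    let ℓ , lower , upper = ⌊log₂⌋-exists Δ (≤-trans (m^n>0 2 L) Δ₀≤Δ)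
        L≤ℓ = ≮⇒≥ λ ℓ<L → <⇒≱ upper (≤-trans (^-monoʳ-≤ 2 ℓ<L) Δ₀≤Δ)
    in ≤ℝ-ln (16 * R) ℓ (χCF G) Δ (begin
      2 * χCF G           ≤⟨ *-monoʳ-≤ 2 (χCF≤log G a ℓ Δ≤aδ lower upper L≤ℓ) ⟩
      2 * (8 * (R * ℓ))   ≡⟨ solve 2 (λ R l → con 2 :* (con 8 :* (R :* l)) := con 16 :* R :* l) refl R ℓ ⟩
      16 * R * ℓ          ∎) lower
    where
    open ≤-Reasoning
    open +-*-Solver
    Δ = maxDegree G
    Δ≤aδ : Δ ≤ a * suc (minDegree G)
    Δ≤aδ = proj₂ (*ℝ-≤ℝ⇒≤ {α} 0<α) Δ (minDegree G) αΔ≤δ
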